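{- For every integer $r \geq 2$ there exists $C = C(r) > 0$ such that the following holds. Let $G$ be an $n$-vertex graph satisfying one of the following conditions: (1) $G$ is $3$-connected; (2) $G$ is $2$-connected and $s_r(G) \geq C\sqrt{n}$. Then $\mathcal{D}_r(G,\mathcal{T}_n) \geq \lfloor s_r(G)/C \rfloor$.
   Context: Graphs are finite and simple; "$k$-connected" means $k$-vertex-connected. Spanning-tree discrepancy: for a connected $n$-vertex graph $G$, an $r$-colouring $f:E(G)\to[r]$ of its edges, and a spanning tree $T$ of $G$ (which has $n-1$ edges), put $D_f(T) := r\cdot\left(\max_{1\le i\le r}|f^{ -1}(i)\cap E(T)| - \frac{n-1}{r}\right)$. The $r$-colour spanning-tree discrepancy of $G$ is $\mathcal{D}_r(G,\mathcal{T}_n) := \min_{f:E(G)\to[r]}\ \max_{T} D_f(T)$, where the maximum is over all spanning trees $T$ of $G$. Balanced $r$-separation number: $s_r(G)$ is the minimum $s$ for which there is a partition $V(G)=V_1\cup\dots\cup V_r\cup S$ with $|V_1|=\dots=|V_r|$, $|S|=s$, and no edges of $G$ between $V_i$ and $V_j$ for any $1\le i<j\le r$ (the parts may be empty). -}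

module Defs where

open import Data.Bool.Base using (Bool; true; false; T)
open import Data.Bool.Properties using (T?)
open import Data.Fin.Base using (Fin; zero; suc; inject₁; fromℕ; _<_)
import Data.Fin.Properties as Fin
open import Data.Fin.Subset using (Subset; _∈_; _∉_; _∩_; ∣_∣; Empty)
open import Data.Integer.Base using (ℤ; +_)
import Data.Integer.Base as ℤ
open import Data.List.Base using (List; map; filter; length; mapMaybe; allFin; cartesianProduct)
import Data.List.Extrema.Nat as Extrema
open import Data.Maybe.Base using (Maybe; just; nothing)
open import Data.Nat.Base using (ℕ; NonZero)
import Data.Nat.Base as ℕ
open import Data.Product.Base using (_×_; _,_; ∃; proj₁)
open import Data.Rational.Base using (ℚ; Positive; floor)
import Data.Rational.Base as ℚ
import Data.Rational.Properties as ℚ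
open import Data.Sum.Base using (_⊎_)
open import Function.Definitions using (Injective)
open import Level using (0ℓ)
open import Relation.Binary.Construct.Closure.ReflexiveTransitive using (Star)
open import Relation.Binary.Core using (Rel)
open import Relation.Binary.PropositionalEquality using (_≡_)
open import Relation.Nullary using (¬_; yes; no)
open import Relation.Unary using (Pred)

record Graph (V : Set) : Set where
  field
    adj        : V → V → Bool
    adj-sym    : ∀ u v → adj u v ≡ adj v u
    adj-irrefl : ∀ v → adj v v ≡ false

  Adj : V → V → Set
  Adj u v = T (adj u v)

open Graph public

Connected : {V : Set} → Graph V → Set
Connected G = ∀ u v → Star (Adj G) u v

_−_ : {n : ℕ} → Graph (Fin n) → (X : Subset n) → Graph (∃ λ v → v ∉ X)
(G − X) .adj u v = adj G (proj₁ u) (proj₁ v)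
(G − X) .adj-sym u v = adj-sym G (proj₁ u) (proj₁ v)
(G − X) .adj-irrefl v = adj-irrefl G (proj₁ v)

-- The bound k < n is the usual convention: K_{k+1} is k-connected, and no
-- graph on at most k vertices is.
_-Connected_ : {n : ℕ} → ℕ → Graph (Fin n) → Set
_-Connected_ {n} k G = k ℕ.< n × (∀ (X : Subset n) → ∣ X ∣ ℕ.< k → Connected (G − X))

record Cycle {V : Set} (G : Graph V) : Set where
  field
    {ℓ}      : ℕ
    vertex   : Fin (3 ℕ.+ ℓ) → V
    distinct : Injective _≡_ _≡_ vertex
    step     : ∀ i → Adj G (vertex (inject₁ i)) (vertex (suc i))
    closing  : Adj G (vertex (fromℕ (2 ℕ.+ ℓ))) (vertex zero)

Acyclic : {V : Set} → Graph V → Set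
Acyclic G = ¬ Cycle G

-- Listing the smaller endpoint first makes each unordered edge occur once.
record Edge {n : ℕ} (G : Graph (Fin n)) : Set where
  constructor edge
  field
    u v      : Fin n
    u<v      : u < v
    adjacent : Adj G u v

edges : {n : ℕ} (G : Graph (Fin n)) → List (Edge G)
edges {n} G = mapMaybe toEdge (cartesianProduct (allFin n) (allFin n))
  where
  toEdge : Fin n × Fin n → Maybe (Edge G)
  toEdge (u , v) with u Fin.<? v | T? (adj G u v)
  ... | yes u<v | yes uv = just (edge u v u<v uv)
  ... | _       | _      = nothing

record SpanningTree {n : ℕ} (G : Graph (Fin n)) : Set where
  field
    tree      : Graph (Fin n)
    subgraph  : ∀ {u v} → Adj tree u v → Adj G u v
    connected : Connected tree
    acyclic   : Acyclic tree

  include : Edge tree → Edge G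
  include (edge u v u<v uv) = edge u v u<v (subgraph uv)

open SpanningTree public

Colouring : {n : ℕ} → ℕ → Graph (Fin n) → Set
Colouring r G = Edge G → Fin r

module _ {n r : ℕ} {G : Graph (Fin n)} (f : Colouring r G) (S : SpanningTree G) where

  colourCount : Fin r → ℕ
  colourCount i = length (filter (λ e → f (include S e) Fin.≟ i) (edges (tree S)))

  maxColourCount : ℕ
  maxColourCount = Extrema.max 0 (map colourCount (allFin r))

  treeDiscrepancy : .{{_ : NonZero r}} → ℚ
  treeDiscrepancy = (+ r ℚ./ 1) ℚ.* ((+ maxColourCount ℚ./ 1) ℚ.- ((+ n ℤ.- + 1) ℚ./ r))

module _ {A : Set} (_≤_ : Rel A 0ℓ) (P : Pred A 0ℓ) where

  IsMinimum : Pred A 0ℓ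
  IsMinimum m = P m × (∀ {x} → P x → m ≤ x)

  IsMaximum : Pred A 0ℓ
  IsMaximum m = P m × (∀ {x} → P x → x ≤ m)

-- Minima and maxima are given by their defining property. They exist here
-- because everything is finite (and, for the maximum over spanning trees,
-- because G is connected).

IsMaxTreeDiscrepancy : {n r : ℕ} .{{_ : NonZero r}} {G : Graph (Fin n)} → Colouring r G → ℚ → Set
IsMaxTreeDiscrepancy {G = G} f =
  IsMaximum ℚ._≤_ (λ d → ∃ λ (S : SpanningTree G) → treeDiscrepancy f S ≡ d)

IsSpanningTreeDiscrepancy : {n : ℕ} (r : ℕ) .{{_ : NonZero r}} → Graph (Fin n) → ℚ → Set
IsSpanningTreeDiscrepancy r G =
  IsMinimum ℚ._≤_ (λ d → ∃ λ (f : Colouring r G) → IsMaxTreeDiscrepancy f d)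

record BalancedSeparation {n : ℕ} (r : ℕ) (G : Graph (Fin n)) : Set where
  field
    part        : Fin r → Subset n
    separator   : Subset n
    covers      : ∀ v → (∃ λ i → v ∈ part i) ⊎ v ∈ separator
    disjoint    : ∀ {i j} → i < j → Empty (part i ∩ part j)
    disjoint-S  : ∀ i → Empty (part i ∩ separator)
    balanced    : ∀ i j → ∣ part i ∣ ≡ ∣ part j ∣
    no-crossing : ∀ {i j} → i < j → ∀ {u v} → u ∈ part i → v ∈ part j → ¬ Adj G u v

open BalancedSeparation public

IsSeparationNumber : {n : ℕ} (r : ℕ) → Graph (Fin n) → ℕ → Set
IsSeparationNumber r G =
  IsMinimum ℕ._≤_ (λ s → ∃ λ (B : BalancedSeparation r G) → ∣ separator B ∣ ≡ s)

-- For C > 0 this is s ≥ C √n, with both (nonnegative) sides squared.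
_≥_√_ : ℕ → ℚ → ℕ → Set
s ≥ C √ n = (C ℚ.* C) ℚ.* (+ n ℚ./ 1) ℚ.≤ (+ s ℚ./ 1) ℚ.* (+ s ℚ./ 1)

⌊_÷_⌋ : ℕ → (C : ℚ) .{{_ : Positive C}} → ℤ
⌊ s ÷ C ⌋ = floor ((+ s ℚ./ 1) ℚ.÷ C)
  where instance _ = ℚ.pos⇒nonZero C

{-# OPTIONS --safe #-}

-- Fix a colouring for which every spanning tree has at most m edges of each colour, and let
-- e = r m - (n - 1).  A spanning tree grown so as to prefer colour i contains a maximal forest of
-- that colour, so the components of colour i number at least n - m.  Let W be the set of vertices
-- that lie in nontrivial components of at least two colours.  By 2-connectivity a nontrivial
-- component meets W in at least two vertices, and counting the incidences between components and W
-- twice shows that, up to O(e) exceptions, components have exactly two vertices in W and vertices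
-- of W lie in exactly two components: the components form paths and cycles.
--
-- Delete the exceptional vertices of W.  What remains of the exceptional components of colour i is
-- put into cell i, which has then at most m + O(e) vertices.  If G is 3-connected, the other
-- components are single edges; in general those with more than √n vertices, of which there are
-- O(√n), are treated as exceptional too.  The remaining paths and cycles are distributed among the
-- cells one component after the other, filling one cell at a time, and two vertices are deleted
-- whenever a cell is full.  No cell ends up with more than m + O(e) vertices, respectively
-- m + O(e + √n), and r m = n - 1 + e, so deleting as many more vertices makes the cells equal.

module Submission where

open import Defs
open import Data.Nat.Base using (ℕ; NonZero; _≤_)
open import Data.Fin.Base using (Fin)
open import Data.Product.Base using (_×_; Σ-syntax)
open import Data.Rational.Base using (ℚ; Positive; _/_)
import Data.Rational.Base as ℚ
open import Data.Sum.Base using (_⊎_)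

import Data.Nat.Properties
open import Algebra.Properties.Semiring.Sum Data.Nat.Properties.+-*-semiring
open import Data.Bool.Base using (true; T; if_then_else_)
open import Data.Bool.Properties using (T?; T-irrelevant)
import Data.Bool.Properties as Bool
open import Data.Empty using (⊥; ⊥-elim)
open import Data.Fin.Base using (toℕ; fromℕ<; zero; suc; punchIn; inject₁; fromℕ)
open import Data.Fin.Properties using (_≟_; any?)
import Data.Fin.Properties as Fin
open import Data.Fin.Relation.Unary.Top using (view; ‵fromℕ; ‵inject₁)
open import Data.Fin.Subset using (Subset; _∈_; _∉_; ∣_∣; inside; outside) renaming (⊥ to ⊥ₛ)
open import Data.Fin.Subset.Properties using (_∈?_; drop-there; x∈p∩q⁻; ∉⊥; ∣⊥∣≡0)
open import Data.Integer.Base using (ℤ)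
import Data.Integer.Base as ℤ
import Data.Integer.DivMod as ℤ
import Data.Integer.Properties as ℤ
open import Data.List.Base using (List; []; _∷_; length; map; filter; mapMaybe; allFin; cartesianProduct)
import Data.List.Extrema.Nat as Extrema
open import Data.List.Membership.Propositional using () renaming (_∈_ to _∈ₗ_; _∉_ to _∉ₗ_)
open import Data.List.Membership.Propositional.Properties using (∈-allFin; ∈-cartesianProduct⁺; ∈-filter⁺; ∈-map⁺)
open import Data.List.Properties using (length-map)
import Data.List.Relation.Unary.All as All
open import Data.List.Relation.Unary.Any using () renaming (here to hereₗ; there to thereₗ)
import Data.List.Relation.Unary.Any as Any
open import Data.Maybe.Base using (Maybe; just; nothing)
open import Data.Nat.Base using (zero; suc; _+_; _*_; _∸_; _<_; z≤n; s≤s)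
import Data.Nat.Coprimality as Coprimality
open import Data.Nat.Induction using (Acc; acc; <-wellFounded)
open import Data.Nat.Properties using
  ( module ≤-Reasoning; ≤-refl; ≤-trans; ≤-reflexive; ≤-antisym; <-irrefl; _≤?_; _<?_; ≰⇒>; ≮⇒≥
  ; +-mono-≤; +-monoʳ-≤; +-monoˡ-≤; *-mono-≤; *-monoʳ-≤; *-monoˡ-≤; +-cancelˡ-≤; +-cancelʳ-≤
  ; +-comm; +-assoc; +-identityʳ; *-comm; *-identityˡ; m≤m+n; m≤n+m; n≤1+n; m+[n∸m]≡n; m≤n+m∸n )
import Data.Nat.Properties as ℕ
open import Data.Nat.Tactic.RingSolver using (solve-∀)
open import Data.Product.Base using (∃; ∃₂; _,_; proj₁; proj₂)
open import Data.Rational.Base using (floor)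
import Data.Rational.Properties as ℚ
import Data.Rational.Unnormalised.Base as ℚᵘ
import Data.Rational.Unnormalised.Properties as ℚᵘ
open import Data.Sum.Base using (inj₁; inj₂; [_,_]′)
open import Data.Vec.Base using ([]; _∷_; tabulate; here; there)
import Data.Vec.Properties as Vec
open import Function.Base using (_∘_; id; case_of_)
open import Relation.Binary.Construct.Closure.ReflexiveTransitive using (Star; ε; _◅_; gmap; _◅◅_; reverse)
open import Relation.Binary.Definitions using (tri<; tri≈; tri>)
open import Relation.Binary.PropositionalEquality using (_≡_; _≢_; refl; sym; trans; cong; cong₂; subst; subst₂; module ≡-Reasoning)
open import Relation.Nullary using (¬_; Dec; yes; no; contradiction)
open import Relation.Nullary.Decidable using (_×-dec_; _⊎-dec_; ¬?; does; dec-true; dec-false; decidable-stable)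

-- Indicators and finite sums.

⟦_⟧ : {P : Set} → Dec P → ℕ
⟦ yes _ ⟧ = 1
⟦ no  _ ⟧ = 0

⟦⟧-yes : {P : Set} (P? : Dec P) → P → ⟦ P? ⟧ ≡ 1
⟦⟧-yes (yes _) p = refl
⟦⟧-yes (no ¬p) p = contradiction p ¬p

⟦⟧-no : {P : Set} (P? : Dec P) → ¬ P → ⟦ P? ⟧ ≡ 0
⟦⟧-no (yes p) ¬p = contradiction p ¬p
⟦⟧-no (no _)  ¬p = refl

⟦⟧-≤ : {P : Set} (P? : Dec P) {k : ℕ} → (P → 1 ≤ k) → ⟦ P? ⟧ ≤ k
⟦⟧-≤ (yes p) f = f p
⟦⟧-≤ (no _)  f = z≤n

⟦⟧-mono : {P Q : Set} (P? : Dec P) (Q? : Dec Q) → (P → Q) → ⟦ P? ⟧ ≤ ⟦ Q? ⟧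
⟦⟧-mono P? Q? f = ⟦⟧-≤ P? (λ p → ≤-reflexive (sym (⟦⟧-yes Q? (f p))))

⟦⟧-cong : {P Q : Set} (P? : Dec P) (Q? : Dec Q) → (P → Q) → (Q → P) → ⟦ P? ⟧ ≡ ⟦ Q? ⟧
⟦⟧-cong P? Q? f g = ≤-antisym (⟦⟧-mono P? Q? f) (⟦⟧-mono Q? P? g)

module _ {n : ℕ} where

  sum-0 : {f : Fin n → ℕ} → (∀ i → f i ≡ 0) → sum f ≡ 0
  sum-0 f≡0 = trans (sum-cong-≗ f≡0) (sum-replicate-zero n)

  *-distribʳ-∑ : (f : Fin n → ℕ) (k : ℕ) → sum f * k ≡ ∑[ i < n ] (f i * k)
  *-distribʳ-∑ f k = *-distribʳ-sum k f

sum-mono : {n : ℕ} {f g : Fin n → ℕ} → (∀ i → f i ≤ g i) → sum f ≤ sum g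
sum-mono {zero}  f≤g = z≤n
sum-mono {suc n} f≤g = +-mono-≤ (f≤g zero) (sum-mono (f≤g ∘ suc))

sum-const : (n k : ℕ) → ∑[ i < n ] k ≡ n * k
sum-const zero    k = refl
sum-const (suc n) k = cong (k +_) (sum-const n k)

term≤sum : {n : ℕ} (f : Fin n → ℕ) (i : Fin n) → f i ≤ sum f
term≤sum f zero    = m≤m+n (f zero) _
term≤sum f (suc i) = ≤-trans (term≤sum (f ∘ suc) i) (m≤n+m _ (f zero))

two-terms≤sum : {n : ℕ} (f : Fin n → ℕ) {i j : Fin n} → i ≢ j → f i + f j ≤ sum f
two-terms≤sum f {zero}  {zero}  i≢j = contradiction refl i≢j
two-terms≤sum f {zero}  {suc j} i≢j = +-monoʳ-≤ (f zero) (term≤sum (f ∘ suc) j)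
two-terms≤sum f {suc i} {zero}  i≢j =
  ≤-trans (≤-reflexive (+-comm (f (suc i)) (f zero))) (+-monoʳ-≤ (f zero) (term≤sum (f ∘ suc) i))
two-terms≤sum f {suc i} {suc j} i≢j =
  ≤-trans (two-terms≤sum (f ∘ suc) (i≢j ∘ cong suc)) (m≤n+m _ (f zero))

three-terms≤sum : {n : ℕ} (f : Fin n → ℕ) {i j k : Fin n} → i ≢ j → i ≢ k → j ≢ k →
                  f i + (f j + f k) ≤ sum f
three-terms≤sum f {zero}  {zero}  {_}     i≢j i≢k j≢k = contradiction refl i≢j
three-terms≤sum f {zero}  {suc _} {zero}  i≢j i≢k j≢k = contradiction refl i≢k
three-terms≤sum f {suc _} {zero}  {zero}  i≢j i≢k j≢k = contradiction refl j≢k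
three-terms≤sum f {zero}  {suc j} {suc k} i≢j i≢k j≢k =
  +-monoʳ-≤ (f zero) (two-terms≤sum (f ∘ suc) (j≢k ∘ cong suc))
three-terms≤sum f {suc i} {zero}  {suc k} i≢j i≢k j≢k =
  ≤-trans (≤-reflexive (shuffle (f (suc i)) (f zero) (f (suc k))))
          (+-monoʳ-≤ (f zero) (two-terms≤sum (f ∘ suc) (i≢k ∘ cong suc)))
  where
  shuffle : ∀ a b c → a + (b + c) ≡ b + (a + c)
  shuffle = solve-∀
three-terms≤sum f {suc i} {suc j} {zero}  i≢j i≢k j≢k =
  ≤-trans (≤-reflexive (shuffle (f (suc i)) (f (suc j)) (f zero)))
          (+-monoʳ-≤ (f zero) (two-terms≤sum (f ∘ suc) (i≢j ∘ cong suc)))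
  where
  shuffle : ∀ a b c → a + (b + c) ≡ c + (a + b)
  shuffle = solve-∀
three-terms≤sum f {suc i} {suc j} {suc k} i≢j i≢k j≢k =
  ≤-trans (three-terms≤sum (f ∘ suc) (i≢j ∘ cong suc) (i≢k ∘ cong suc) (j≢k ∘ cong suc))
          (m≤n+m _ (f zero))

sum-mono-< : {n : ℕ} {f g : Fin n → ℕ} → (∀ i → f i ≤ g i) → (i : Fin n) → f i < g i → sum f < sum g
sum-mono-< f≤g zero    fi<gi = +-mono-≤ fi<gi (sum-mono (f≤g ∘ suc))
sum-mono-< {f = f} {g} f≤g (suc i) fi<gi =
  ≤-trans (≤-reflexive (sym (ℕ.+-suc (f zero) _)))
          (+-mono-≤ (f≤g zero) (sum-mono-< (f≤g ∘ suc) i fi<gi))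

sum-point : {n : ℕ} (F : Fin n → ℕ) (y : Fin n) → ∑[ x < n ] (⟦ y ≟ x ⟧ * F x) ≡ F y
sum-point {n} F y = ≤-antisym upper lower
  where
  open ≤-Reasoning
  hit : ⟦ y ≟ y ⟧ * F y ≡ F y
  hit = trans (cong (_* F y) (⟦⟧-yes (y ≟ y) refl)) (*-identityˡ (F y))
  lower : F y ≤ ∑[ x < n ] (⟦ y ≟ x ⟧ * F x)
  lower = ≤-trans (≤-reflexive (sym hit)) (term≤sum (λ x → ⟦ y ≟ x ⟧ * F x) y)
  upper : ∑[ x < n ] (⟦ y ≟ x ⟧ * F x) ≤ F y
  upper = go F y
    where
    go : {m : ℕ} (F : Fin m → ℕ) (y : Fin m) → ∑[ x < m ] (⟦ y ≟ x ⟧ * F x) ≤ F y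
    go {suc m} F zero    = ≤-reflexive (trans (cong₂ _+_ (*-identityˡ (F zero)) (sum-0 {m} λ _ → refl)) (+-identityʳ (F zero)))
    go {suc m} F (suc y) = ≤-trans (≤-reflexive (sum-cong-≗ {m} λ x → cong (_* F (suc x)) (⟦⟧-cong (suc y ≟ suc x) (y ≟ x) Fin.suc-injective (cong suc)))) (go (F ∘ suc) y)

-- Sorts the terms by the value of `g`. With `g = h i` below, a sum over vertices is regrouped by
-- classes.
sum-fibres : {m n : ℕ} (g : Fin m → Fin n) (F : Fin m → Fin n → ℕ) →
             ∑[ v < m ] F v (g v) ≡ ∑[ x < n ] ∑[ v < m ] (⟦ g v ≟ x ⟧ * F v x)
sum-fibres g F = trans (sum-cong-≗ (λ v → sym (sum-point (F v) (g v)))) (∑-comm (λ v x → ⟦ g v ≟ x ⟧ * F v x))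

∣tabulate∣ : {n : ℕ} {P : Fin n → Set} (P? : ∀ v → Dec (P v)) →
             ∣ tabulate (does ∘ P?) ∣ ≡ ∑[ v < n ] ⟦ P? v ⟧
∣tabulate∣ {zero}  P? = refl
∣tabulate∣ {suc n} P? with P? zero
... | yes _ = cong suc (∣tabulate∣ (P? ∘ suc))
... | no  _ = ∣tabulate∣ (P? ∘ suc)

module _ {n : ℕ} {P : Fin n → Set} (P? : ∀ v → Dec (P v)) where

  ∈-tabulate⁺ : ∀ {v} → P v → v ∈ tabulate (does ∘ P?)
  ∈-tabulate⁺ {v} p = Vec.lookup⇒[]= v _ (trans (Vec.lookup∘tabulate (does ∘ P?) v) (holds (P? v)))
    where
    holds : (d : Dec (P v)) → does d ≡ true
    holds (yes _) = refl
    holds (no ¬p) = contradiction p ¬p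

  ∈-tabulate⁻ : ∀ {v} → v ∈ tabulate (does ∘ P?) → P v
  ∈-tabulate⁻ {v} v∈ = holds (P? v) (trans (sym (Vec.lookup∘tabulate (does ∘ P?) v)) (Vec.[]=⇒lookup v∈))
    where
    holds : (d : Dec (P v)) → does d ≡ true → P v
    holds (yes p) _ = p
    holds (no _) ()

-- Counting incidences between vertices and monochromatic components.

-- For a fixed colour i, the map h i sends a vertex to a representative of its class (its
-- monochromatic component); Act i x says that the class represented by x is nontrivial.  The
-- nontrivial classes of all colours are the hyperedges of a hypergraph in which v has degree d v.
-- The indicator of W, the set of vertices of degree at least 2, is w, and b i x is the number of
-- vertices of W in a class.  There are c nontrivial classes, and δ and β measure how far W is
-- from having all degrees 2, and the classes from having two vertices in W each.
module Classes {n r : ℕ} (h : Fin r → Fin n → Fin n) where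

  Act : Fin r → Fin n → Set
  Act i x = ∃ λ u → u ≢ x × h i u ≡ x

  Act? : ∀ i x → Dec (Act i x)
  Act? i x = any? λ u → ¬? (u ≟ x) ×-dec (h i u ≟ x)

  act : Fin r → Fin n → ℕ
  act i x = ⟦ Act? i x ⟧

  d : Fin n → ℕ
  d v = ∑[ i < r ] act i (h i v)

  w : Fin n → ℕ
  w v = ⟦ 2 ≤? d v ⟧

  -- When `h i` is idempotent, the sum of `nh i` is `n` minus the number of classes of colour `i`.
  -- If the classes are the components of that colour, this is the number of edges of a maximal
  -- forest in it.
  nh : Fin r → Fin n → ℕ
  nh i v = ⟦ ¬? (h i v ≟ v) ⟧

  size : Fin r → Fin n → ℕ
  size i x = ∑[ v < n ] ⟦ h i v ≟ x ⟧

  b : Fin r → Fin n → ℕ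
  b i x = ∑[ v < n ] (⟦ h i v ≟ x ⟧ * w v)

  c δ β : ℕ
  c = ∑[ i < r ] ∑[ x < n ] act i x
  δ = ∑[ v < n ] (w v * (d v ∸ 2))
  β = ∑[ i < r ] ∑[ x < n ] (act i x * (b i x ∸ 2))

  shared⇒act : ∀ i {u v} → h i u ≡ h i v → u ≢ v → Act i (h i u)
  shared⇒act i {u} {v} eq u≢v with u ≟ h i u
  ... | no u≢x  = u , u≢x , refl
  ... | yes u≡x = v , (λ v≡x → u≢v (trans u≡x (sym v≡x))) , sym eq

  private
    1≤act : ∀ {i x} → Act i x → 1 ≤ act i x
    1≤act {i} {x} a = ≤-reflexive (sym (⟦⟧-yes (Act? i x) a))

  act⇒1≤d : ∀ {i v} → Act i (h i v) → 1 ≤ d v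
  act⇒1≤d {i} {v} a = ≤-trans (1≤act a) (term≤sum (λ i → act i (h i v)) i)

  1≤d⇒act : ∀ {v} → 1 ≤ d v → ∃ λ i → Act i (h i v)
  1≤d⇒act {v} 1≤d with any? (λ i → Act? i (h i v))
  ... | yes ∃a = ∃a
  ... | no  ∄a = contradiction (≤-trans 1≤d (≤-reflexive (sum-0 λ i → ⟦⟧-no (Act? i (h i v)) (λ a → ∄a (i , a))))) λ ()

  act₂⇒2≤d : ∀ {i j v} → i ≢ j → Act i (h i v) → Act j (h j v) → 2 ≤ d v
  act₂⇒2≤d {v = v} i≢j a a′ = ≤-trans (+-mono-≤ (1≤act a) (1≤act a′)) (two-terms≤sum (λ i → act i (h i v)) i≢j)

  act₃⇒3≤d : ∀ {i j k v} → i ≢ j → i ≢ k → j ≢ k →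
             Act i (h i v) → Act j (h j v) → Act k (h k v) → 3 ≤ d v
  act₃⇒3≤d {v = v} i≢j i≢k j≢k a a′ a″ =
    ≤-trans (+-mono-≤ (1≤act a) (+-mono-≤ (1≤act a′) (1≤act a″)))
            (three-terms≤sum (λ i → act i (h i v)) i≢j i≢k j≢k)

  -- Double counting of the pairs of a vertex of W and a class containing it, weighted by `g` at the
  -- class. The weight `act` yields `Ω`; the indicator of the special classes is used in
  -- `cut-bound`.
  incidences : (g : Fin r → Fin n → ℕ) →
               ∑[ v < n ] (w v * ∑[ i < r ] g i (h i v)) ≡ ∑[ i < r ] ∑[ x < n ] (g i x * b i x)
  incidences g = begin
    ∑[ v < n ] (w v * ∑[ i < r ] g i (h i v))
      ≡⟨ sum-cong-≗ (λ v → *-distribˡ-sum (w v) (λ i → g i (h i v))) ⟩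
    ∑[ v < n ] ∑[ i < r ] (w v * g i (h i v))
      ≡⟨ ∑-comm (λ v i → w v * g i (h i v)) ⟩
    ∑[ i < r ] ∑[ v < n ] (w v * g i (h i v))
      ≡⟨ sum-cong-≗ (λ i → sum-fibres (h i) (λ v x → w v * g i x)) ⟩
    ∑[ i < r ] ∑[ x < n ] ∑[ v < n ] (⟦ h i v ≟ x ⟧ * (w v * g i x))
      ≡⟨ sum-cong-≗ (λ i → sum-cong-≗ (λ x → trans
           (sum-cong-≗ (λ v → shuffle ⟦ h i v ≟ x ⟧ (w v) (g i x)))
           (sym (*-distribˡ-sum (g i x) (λ v → ⟦ h i v ≟ x ⟧ * w v))))) ⟩
    ∑[ i < r ] ∑[ x < n ] (g i x * b i x) ∎
    where
    open ≡-Reasoning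
    shuffle : ∀ p q s → p * (q * s) ≡ s * (p * q)
    shuffle = solve-∀

  -- A vertex of a nontrivial class either is not its representative, and is counted by `nh`, or is
  -- the representative and stands for one of the `c` classes.
  ∑d≤ : {m : ℕ} → (∀ i → ∑[ v < n ] nh i v ≤ m) → ∑[ v < n ] d v ≤ r * m + c
  ∑d≤ {m} nh≤m = begin
    ∑[ v < n ] d v
      ≤⟨ sum-mono (λ v → sum-mono (λ i → split i v)) ⟩
    ∑[ v < n ] ∑[ i < r ] (nh i v + act i v)
      ≡⟨ ∑-comm (λ v i → nh i v + act i v) ⟩
    ∑[ i < r ] ∑[ v < n ] (nh i v + act i v)
      ≡⟨ sum-cong-≗ (λ i → ∑-distrib-+ (nh i) (act i)) ⟩
    ∑[ i < r ] (∑[ v < n ] nh i v + ∑[ v < n ] act i v)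
      ≡⟨ ∑-distrib-+ (λ i → ∑[ v < n ] nh i v) (λ i → ∑[ v < n ] act i v) ⟩
    ∑[ i < r ] ∑[ v < n ] nh i v + c
      ≤⟨ +-monoˡ-≤ c (sum-mono nh≤m) ⟩
    ∑[ i < r ] m + c
      ≡⟨ cong (_+ c) (sum-const r m) ⟩
    r * m + c ∎
    where
    open ≤-Reasoning
    split : ∀ i v → act i (h i v) ≤ nh i v + act i v
    split i v with h i v ≟ v
    ... | yes hv≡v = ≤-reflexive (cong (act i) hv≡v)
    ... | no  _    = ≤-trans (⟦⟧-≤ (Act? i (h i v)) (λ _ → ≤-refl)) (m≤m+n 1 _)

  private
    Ω ∣W∣ : ℕ
    Ω = ∑[ v < n ] (w v * d v)
    ∣W∣ = ∑[ v < n ] w v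

    2≤⇒split : ∀ {k} → 2 ≤ k → 2 + (k ∸ 2) ≡ k
    2≤⇒split = m+[n∸m]≡n

    w-split : ∀ v → w v * d v ≡ 2 * w v + w v * (d v ∸ 2)
    w-split v with 2 ≤? d v
    ... | no  _   = refl
    ... | yes 2≤d = trans (+-identityʳ (d v)) (trans (sym (2≤⇒split 2≤d)) (sym (cong (2 +_) (+-identityʳ (d v ∸ 2)))))

    Ω≡2∣W∣+δ : Ω ≡ 2 * ∣W∣ + δ
    Ω≡2∣W∣+δ = trans (sum-cong-≗ w-split)
                (trans (∑-distrib-+ (λ v → 2 * w v) (λ v → w v * (d v ∸ 2)))
                       (cong (_+ δ) (sym (*-distribˡ-sum 2 w))))

    Ω≡2c+β : (∀ {i x} → Act i x → 2 ≤ b i x) → Ω ≡ 2 * c + β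
    Ω≡2c+β 2≤b = begin
      Ω
        ≡⟨ incidences act ⟩
      ∑[ i < r ] ∑[ x < n ] (act i x * b i x)
        ≡⟨ sum-cong-≗ (λ i → trans (sum-cong-≗ (split i))
             (trans (∑-distrib-+ (λ x → 2 * act i x) (λ x → act i x * (b i x ∸ 2)))
               (cong (_+ ∑[ x < n ] (act i x * (b i x ∸ 2))) (sym (*-distribˡ-sum 2 (act i)))))) ⟩
      ∑[ i < r ] (2 * ∑[ x < n ] act i x + ∑[ x < n ] (act i x * (b i x ∸ 2)))
        ≡⟨ ∑-distrib-+ (λ i → 2 * ∑[ x < n ] act i x) (λ i → ∑[ x < n ] (act i x * (b i x ∸ 2))) ⟩
      ∑[ i < r ] (2 * ∑[ x < n ] act i x) + β
        ≡⟨ cong (_+ β) (sym (*-distribˡ-sum 2 (λ i → ∑[ x < n ] act i x))) ⟩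
      2 * c + β ∎
      where
      open ≡-Reasoning
      split : ∀ i x → act i x * b i x ≡ 2 * act i x + act i x * (b i x ∸ 2)
      split i x with Act? i x
      ... | no  _ = refl
      ... | yes a = trans (+-identityʳ (b i x)) (trans (sym (2≤⇒split (2≤b a))) (sym (cong (2 +_) (+-identityʳ (b i x ∸ 2)))))

    -- At a vertex of W the two sides of `1 + w v * d v ≤ d v + w v` agree; elsewhere this says
    -- `1 ≤ d v`.
    n+Ω≤ : (∀ v → 1 ≤ d v) → n + Ω ≤ ∑[ v < n ] d v + ∣W∣
    n+Ω≤ 1≤d = begin
      n + Ω
        ≡⟨ cong (_+ Ω) (trans (sym (ℕ.*-identityʳ n)) (sym (sum-const n 1))) ⟩
      ∑[ v < n ] 1 + Ω
        ≡⟨ sym (∑-distrib-+ {n} (λ _ → 1) (λ v → w v * d v)) ⟩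
      ∑[ v < n ] (1 + w v * d v)
        ≤⟨ sum-mono pointwise ⟩
      ∑[ v < n ] (d v + w v)
        ≡⟨ ∑-distrib-+ d w ⟩
      ∑[ v < n ] d v + ∣W∣ ∎
      where
      open ≤-Reasoning
      pointwise : ∀ v → 1 + w v * d v ≤ d v + w v
      pointwise v with 2 ≤? d v
      ... | yes _ = ≤-reflexive (trans (cong suc (+-identityʳ (d v))) (+-comm 1 (d v)))
      ... | no  _ = ≤-trans (1≤d v) (m≤m+n (d v) 0)

  -- Twice n + Ω ≤ r m + c + |W|, where Ω counts the incidences between the classes and the
  -- vertices of degree at least 2, so that Ω = 2 c + β = 2 |W| + δ.
  excess-bound : {m : ℕ} → (∀ i → ∑[ v < n ] nh i v ≤ m) → (∀ v → 1 ≤ d v) →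
                 (∀ {i x} → Act i x → 2 ≤ b i x) → 2 * n + (β + δ) ≤ 2 * (r * m)
  excess-bound {m} nh≤m 1≤d 2≤b = +-cancelʳ-≤ (2 * c + 2 * ∣W∣) _ _ (begin
    2 * n + (β + δ) + (2 * c + 2 * ∣W∣)        ≡⟨ shuffle n β δ c ∣W∣ ⟩
    2 * n + ((2 * c + β) + (2 * ∣W∣ + δ))      ≡⟨ cong (2 * n +_) (cong₂ _+_ (sym (Ω≡2c+β 2≤b)) (sym Ω≡2∣W∣+δ)) ⟩
    2 * n + (Ω + Ω)                            ≡⟨ twice n Ω ⟩
    2 * (n + Ω)                                ≤⟨ *-monoʳ-≤ 2 (≤-trans (n+Ω≤ 1≤d) (+-monoˡ-≤ ∣W∣ (∑d≤ nh≤m))) ⟩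
    2 * (r * m + c + ∣W∣)                      ≡⟨ regroup (r * m) c ∣W∣ ⟩
    2 * (r * m) + (2 * c + 2 * ∣W∣)            ∎)
    where
    open ≤-Reasoning
    shuffle : ∀ n β δ c k → 2 * n + (β + δ) + (2 * c + 2 * k) ≡ 2 * n + ((2 * c + β) + (2 * k + δ))
    shuffle = solve-∀
    twice : ∀ n o → 2 * n + (o + o) ≡ 2 * (n + o)
    twice = solve-∀
    regroup : ∀ R c k → 2 * (R + c + k) ≡ 2 * R + (2 * c + 2 * k)
    regroup = solve-∀

-- Exceptional vertices and classes.

-- Outside the exceptional vertices (Cut) and the special classes, the hypergraph consists of paths
-- and cycles of classes with at most q elements.
module Special {n r : ℕ} (h : Fin r → Fin n → Fin n) (q : ℕ) where

  open Classes h

  Special : Fin r → Fin n → Set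
  Special i x = Act i x × (3 ≤ b i x ⊎ q < size i x)

  Special? : ∀ i x → Dec (Special i x)
  Special? i x = Act? i x ×-dec ((3 ≤? b i x) ⊎-dec (q <? size i x))

  Cut : Fin n → Set
  Cut v = 3 ≤ d v ⊎ (2 ≤ d v × ∃ λ i → Special i (h i v))

  Cut? : ∀ v → Dec (Cut v)
  Cut? v = (3 ≤? d v) ⊎-dec ((2 ≤? d v) ×-dec any? (λ i → Special? i (h i v)))

  private
    big sp : Fin r → Fin n → ℕ
    big i x = ⟦ q <? size i x ⟧
    sp i x  = ⟦ Special? i x ⟧

  N : ℕ
  N = ∑[ i < r ] ∑[ x < n ] big i x

  -- The classes of each colour partition the vertices, so all sizes add up to `r * n`, and each
  -- class counted by `N` contributes at least `q + 1`.
  N-bound : N * suc q ≤ r * n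
  N-bound = begin
    N * suc q
      ≡⟨ *-distribʳ-∑ (λ i → ∑[ x < n ] big i x) (suc q) ⟩
    ∑[ i < r ] ((∑[ x < n ] big i x) * suc q)
      ≡⟨ sum-cong-≗ (λ i → *-distribʳ-∑ (big i) (suc q)) ⟩
    ∑[ i < r ] ∑[ x < n ] (big i x * suc q)
      ≤⟨ sum-mono (λ i → sum-mono (big≤size i)) ⟩
    ∑[ i < r ] ∑[ x < n ] size i x
      ≡⟨ sum-cong-≗ ∑size ⟩
    ∑[ i < r ] n
      ≡⟨ sum-const r n ⟩
    r * n ∎
    where
    open ≤-Reasoning
    big≤size : ∀ i x → big i x * suc q ≤ size i x
    big≤size i x with q <? size i x
    ... | yes q<s = ≤-trans (≤-reflexive (+-identityʳ (suc q))) q<s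
    ... | no  _   = z≤n
    ∑size : ∀ i → ∑[ x < n ] size i x ≡ n
    ∑size i = trans
      (sum-cong-≗ (λ x → sum-cong-≗ (λ v → sym (ℕ.*-identityʳ ⟦ h i v ≟ x ⟧))))
      (trans (sym (sum-fibres (h i) (λ _ _ → 1))) (trans (sum-const n 1) (ℕ.*-identityʳ n)))

  private
    ∑-β+N : (f : Fin r → Fin n → ℕ) (l k : ℕ) →
            (∀ i x → f i x ≤ l * (act i x * (b i x ∸ 2)) + k * big i x) →
            ∑[ i < r ] ∑[ x < n ] f i x ≤ l * β + k * N
    ∑-β+N f l k f≤ = begin
      ∑[ i < r ] ∑[ x < n ] f i x
        ≤⟨ sum-mono (λ i → sum-mono (f≤ i)) ⟩
      ∑[ i < r ] ∑[ x < n ] (l * e i x + k * big i x)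
        ≡⟨ sum-cong-≗ (λ i → trans (∑-distrib-+ (λ x → l * e i x) (λ x → k * big i x))
             (cong₂ _+_ (sym (*-distribˡ-sum l (e i))) (sym (*-distribˡ-sum k (big i))))) ⟩
      ∑[ i < r ] (l * ∑[ x < n ] e i x + k * ∑[ x < n ] big i x)
        ≡⟨ trans (∑-distrib-+ (λ i → l * ∑[ x < n ] e i x) (λ i → k * ∑[ x < n ] big i x))
             (cong₂ _+_ (sym (*-distribˡ-sum l (λ i → ∑[ x < n ] e i x)))
                        (sym (*-distribˡ-sum k (λ i → ∑[ x < n ] big i x)))) ⟩
      l * β + k * N ∎
      where
      open ≤-Reasoning
      e : Fin r → Fin n → ℕ
      e i x = act i x * (b i x ∸ 2)

    sp-bound : ∀ i x → sp i x ≤ 1 * (act i x * (b i x ∸ 2)) + 1 * big i x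
    sp-bound i x = ⟦⟧-≤ (Special? i x) bound
      where
      simp : ∀ a k → a ≡ 1 → 1 * (a * k) ≡ k
      simp _ k refl = trans (*-identityˡ (1 * k)) (*-identityˡ k)
      bound : Special i x → 1 ≤ 1 * (act i x * (b i x ∸ 2)) + 1 * big i x
      bound (a , inj₁ 3≤b) = ≤-trans (ℕ.∸-monoˡ-≤ 2 3≤b)
        (≤-trans (≤-reflexive (sym (simp (act i x) _ (⟦⟧-yes (Act? i x) a)))) (m≤m+n _ _))
      bound (a , inj₂ q<s) = ≤-trans
        (≤-reflexive (sym (trans (*-identityˡ (big i x)) (⟦⟧-yes (q <? size i x) q<s)))) (m≤n+m (1 * big i x) (1 * (act i x * (b i x ∸ 2))))

    -- If `b ≥ 3` then `b ≤ 3 * (b ∸ 2)`; a large class has `b = (b ∸ 2) + 2`. The coefficients 3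
    -- and 2 in `cut-bound` come from here.
    sp*b-bound : (∀ {i x} → Act i x → 2 ≤ b i x) →
                 ∀ i x → sp i x * b i x ≤ 3 * (act i x * (b i x ∸ 2)) + 2 * big i x
    sp*b-bound 2≤b i x with Special? i x
    ... | no _ = z≤n
    ... | yes (a , inj₁ 3≤b) rewrite ⟦⟧-yes (Act? i x) a | +-identityʳ (b i x) | +-identityʳ (b i x ∸ 2) =
      ≤-trans (triple 3≤b) (m≤m+n _ _)
      where
      triple : ∀ {k} → 3 ≤ k → k ≤ 3 * (k ∸ 2)
      triple {suc (suc (suc k))} (s≤s (s≤s (s≤s _))) = ≤-trans (m≤m+n (3 + k) (2 * k)) (≤-reflexive (eq k))
        where
        eq : ∀ k → 3 + k + 2 * k ≡ 3 * (1 + k)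
        eq = solve-∀
    ... | yes (a , inj₂ q<s) rewrite ⟦⟧-yes (Act? i x) a | ⟦⟧-yes (q <? size i x) q<s | +-identityʳ (b i x) | +-identityʳ (b i x ∸ 2) =
      ≤-trans (≤-reflexive (trans (sym (m+[n∸m]≡n (2≤b a))) (+-comm 2 _))) (+-monoˡ-≤ 2 (m≤m+n _ _))

  -- As in `∑d≤`: at most `m` of these vertices are not representatives, and each representative
  -- belongs to a special class, which contributes to `β` or to `N`.
  special-bound : {m : ℕ} → (∀ i → ∑[ v < n ] nh i v ≤ m) →
                  ∀ i → ∑[ v < n ] sp i (h i v) ≤ m + (β + N)
  special-bound {m} nh≤m i = begin
    ∑[ v < n ] sp i (h i v)
      ≤⟨ sum-mono split ⟩
    ∑[ v < n ] (nh i v + sp i v)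
      ≡⟨ ∑-distrib-+ (nh i) (sp i) ⟩
    ∑[ v < n ] nh i v + ∑[ v < n ] sp i v
      ≤⟨ +-mono-≤ (nh≤m i) (term≤sum (λ i → ∑[ v < n ] sp i v) i) ⟩
    m + ∑[ i < r ] ∑[ v < n ] sp i v
      ≤⟨ +-monoʳ-≤ m (∑-β+N sp 1 1 sp-bound) ⟩
    m + (1 * β + 1 * N)
      ≡⟨ cong (m +_) (cong₂ _+_ (*-identityˡ β) (*-identityˡ N)) ⟩
    m + (β + N) ∎
    where
    open ≤-Reasoning
    split : ∀ v → sp i (h i v) ≤ nh i v + sp i v
    split v with h i v ≟ v
    ... | yes hv≡v = ≤-reflexive (cong (sp i) hv≡v)
    ... | no  _    = ≤-trans (⟦⟧-≤ (Special? i (h i v)) (λ _ → ≤-refl)) (m≤m+n 1 _)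

  -- A vertex of degree at least 3 is charged to its term in `δ`, any other vertex of `Cut` to an
  -- incidence with a special class. These incidences are then counted class by class.
  cut-bound : (∀ {i x} → Act i x → 2 ≤ b i x) → ∑[ v < n ] ⟦ Cut? v ⟧ ≤ δ + (3 * β + 2 * N)
  cut-bound 2≤b = begin
    ∑[ v < n ] ⟦ Cut? v ⟧
      ≤⟨ sum-mono split ⟩
    ∑[ v < n ] (w v * (d v ∸ 2) + w v * ∑[ i < r ] sp i (h i v))
      ≡⟨ ∑-distrib-+ (λ v → w v * (d v ∸ 2)) (λ v → w v * ∑[ i < r ] sp i (h i v)) ⟩
    δ + ∑[ v < n ] (w v * ∑[ i < r ] sp i (h i v))
      ≡⟨ cong (δ +_) (incidences sp) ⟩
    δ + ∑[ i < r ] ∑[ x < n ] (sp i x * b i x)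
      ≤⟨ +-monoʳ-≤ δ (∑-β+N (λ i x → sp i x * b i x) 3 2 (sp*b-bound 2≤b)) ⟩
    δ + (3 * β + 2 * N) ∎
    where
    open ≤-Reasoning
    w≡1 : ∀ v → 2 ≤ d v → ∀ k → w v * k ≡ k
    w≡1 v 2≤d k = trans (cong (_* k) (⟦⟧-yes (2 ≤? d v) 2≤d)) (*-identityˡ k)
    split : ∀ v → ⟦ Cut? v ⟧ ≤ w v * (d v ∸ 2) + w v * ∑[ i < r ] sp i (h i v)
    split v = ⟦⟧-≤ (Cut? v) λ where
      (inj₁ 3≤d) → ≤-trans (ℕ.∸-monoˡ-≤ 2 3≤d)
        (≤-trans (≤-reflexive (sym (w≡1 v (≤-trans (s≤s (s≤s z≤n)) 3≤d) _))) (m≤m+n _ _))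
      (inj₂ (2≤d , i , s)) → ≤-trans (≤-reflexive (sym (⟦⟧-yes (Special? i (h i v)) s)))
        (≤-trans (term≤sum (λ i → sp i (h i v)) i)
        (≤-trans (≤-reflexive (sym (w≡1 v 2≤d _))) (m≤n+m _ _)))

-- From nearly equal cells to a balanced separation.

∑-unique : {k : ℕ} {P : Fin k → Set} (P? : ∀ a → Dec (P a)) → (∀ {a a′} → P a → P a′ → a ≡ a′) →
           ∑[ a < k ] ⟦ P? a ⟧ ≤ 1
∑-unique {k} P? unique with any? P?
... | no  ∄p      = ≤-trans (≤-reflexive (sum-0 λ a → ⟦⟧-no (P? a) (λ p → ∄p (a , p)))) z≤n
... | yes (y , p) = ≤-trans
  (sum-mono (λ a → ≤-trans (⟦⟧-mono (P? a) (y ≟ a) (unique p)) (≤-reflexive (sym (ℕ.*-identityʳ ⟦ y ≟ a ⟧)))))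
  (≤-reflexive (sum-point (λ _ → 1) y))

∣∣≡∑ : {n : ℕ} (X : Subset n) → ∣ X ∣ ≡ ∑[ v < n ] ⟦ v ∈? X ⟧
∣∣≡∑ []            = refl
∣∣≡∑ (inside  ∷ X) = cong suc (trans (∣∣≡∑ X) (sum-cong-≗ λ v → ⟦⟧-cong (v ∈? X) (suc v ∈? (inside ∷ X)) there drop-there))
∣∣≡∑ (outside ∷ X) = trans (∣∣≡∑ X) (sum-cong-≗ λ v → ⟦⟧-cong (v ∈? X) (suc v ∈? (outside ∷ X)) there drop-there)

choose : {n : ℕ} {P : Fin n → Set} (P? : ∀ v → Dec (P v)) (m : ℕ) → m ≤ ∑[ v < n ] ⟦ P? v ⟧ →
         Σ[ X ∈ Subset n ] ((∀ {v} → v ∈ X → P v) × ∣ X ∣ ≡ m)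
choose {zero}  P? zero m≤ = [] , (λ ()) , refl
choose {suc n} {P} P? m m≤ with P? zero | m
... | no  _ | m =
  let X , X⊆P , ∣X∣≡m = choose (P? ∘ suc) m m≤
  in  outside ∷ X , (λ where (there v∈X) → X⊆P v∈X) , ∣X∣≡m
... | yes _ | zero =
  let X , X⊆P , ∣X∣≡m = choose (P? ∘ suc) zero z≤n
  in  outside ∷ X , (λ where (there v∈X) → X⊆P v∈X) , ∣X∣≡m
... | yes p | suc m with m≤
... | s≤s m≤ =
  let X , X⊆P , ∣X∣≡m = choose (P? ∘ suc) m m≤
  in  inside ∷ X , (λ where here → p ; (there v∈X) → X⊆P v∈X) , cong suc ∣X∣≡m

module _ {n r : ℕ} (G : Graph (Fin n)) {C : Fin r → Fin n → Set} (C? : ∀ a v → Dec (C a v))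
         (no-edge : ∀ {a a′ u v} → C a u → C a′ v → Adj G u v → a ≡ a′)
         (disj : ∀ {a a′ v} → C a v → C a′ v → a ≡ a′) where

  private
    cell : Fin r → ℕ
    cell a = ∑[ v < n ] ⟦ C? a v ⟧

  -- Exactly `m` vertices of each cell are kept, and all others go to the separator.
  equalise : (m : ℕ) → (∀ a → m ≤ cell a) →
             ∃ λ (B : BalancedSeparation r G) → ∣ separator B ∣ + r * m ≤ n
  equalise m m≤cell = separation , bound
    where
    X : Fin r → Subset n
    X a = proj₁ (choose (C? a) m (m≤cell a))
    X⊆C : ∀ a {v} → v ∈ X a → C a v
    X⊆C a = proj₁ (proj₂ (choose (C? a) m (m≤cell a)))
    ∣X∣≡m : ∀ a → ∣ X a ∣ ≡ m
    ∣X∣≡m a = proj₂ (proj₂ (choose (C? a) m (m≤cell a)))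
    Left? : ∀ v → Dec (¬ (∃ λ a → v ∈ X a))
    Left? v = ¬? (any? λ a → v ∈? X a)

    separation : BalancedSeparation r G
    separation .part        = X
    separation .separator   = tabulate (does ∘ Left?)
    separation .covers v with any? (λ a → v ∈? X a)
    ... | yes v∈X = inj₁ v∈X
    ... | no  v∉X = inj₂ (∈-tabulate⁺ Left? v∉X)
    separation .disjoint {a} {a′} a<a′ (v , v∈) with x∈p∩q⁻ (X a) (X a′) v∈
    ... | v∈a , v∈a′ = <-irrefl (cong toℕ (disj (X⊆C a v∈a) (X⊆C a′ v∈a′))) a<a′
    separation .disjoint-S a (v , v∈) with x∈p∩q⁻ (X a) _ v∈
    ... | v∈a , v∈S = ∈-tabulate⁻ Left? v∈S (a , v∈a)
    separation .balanced a a′ = trans (∣X∣≡m a) (sym (∣X∣≡m a′))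
    separation .no-crossing {a} {a′} a<a′ u∈a v∈a′ uv =
      <-irrefl (cong toℕ (no-edge (X⊆C a u∈a) (X⊆C a′ v∈a′) uv)) a<a′

    open ≤-Reasoning
    bound : ∣ tabulate (does ∘ Left?) ∣ + r * m ≤ n
    bound = begin
      ∣ tabulate (does ∘ Left?) ∣ + r * m
        ≡⟨ cong₂ _+_ (∣tabulate∣ Left?) (trans (sym (sum-const r m)) (sum-cong-≗ λ a → trans (sym (∣X∣≡m a)) (∣∣≡∑ (X a)))) ⟩
      ∑[ v < n ] ⟦ Left? v ⟧ + ∑[ a < r ] ∑[ v < n ] ⟦ v ∈? X a ⟧
        ≡⟨ cong (∑[ v < n ] ⟦ Left? v ⟧ +_) (∑-comm (λ a v → ⟦ v ∈? X a ⟧)) ⟩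
      ∑[ v < n ] ⟦ Left? v ⟧ + ∑[ v < n ] ∑[ a < r ] ⟦ v ∈? X a ⟧
        ≡⟨ sym (∑-distrib-+ (λ v → ⟦ Left? v ⟧) (λ v → ∑[ a < r ] ⟦ v ∈? X a ⟧)) ⟩
      ∑[ v < n ] (⟦ Left? v ⟧ + ∑[ a < r ] ⟦ v ∈? X a ⟧)
        ≤⟨ sum-mono once ⟩
      ∑[ v < n ] 1
        ≡⟨ trans (sum-const n 1) (ℕ.*-identityʳ n) ⟩
      n ∎
      where
      once : ∀ v → ⟦ Left? v ⟧ + ∑[ a < r ] ⟦ v ∈? X a ⟧ ≤ 1
      once v with any? (λ a → v ∈? X a)
      ... | yes _  = ∑-unique (λ a → v ∈? X a) (λ v∈a v∈a′ → disj (X⊆C _ v∈a) (X⊆C _ v∈a′))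
      ... | no v∉X = s≤s (≤-reflexive (sum-0 λ a → ⟦⟧-no (v ∈? X a) (λ v∈ → v∉X (a , v∈))))

∑≤term+max : {k M : ℕ} (f : Fin (suc k) → ℕ) → (∀ a → f a ≤ M) → ∀ a → sum f ≤ f a + k * M
∑≤term+max {k} {M} f f≤M a = ≤-trans (≤-reflexive (sum-remove {i = a} f))
  (+-monoʳ-≤ (f a) (≤-trans (sum-mono (λ i → f≤M (punchIn a i))) (≤-reflexive (sum-const k M))))

-- The other `r - 1` cells hold at most `M` vertices each, so every cell has at least
-- `n - σ - (r - 1) M`. Cutting all cells down to that size leaves a separator of at most
-- `r σ + (r - 1) (r M - n)` vertices.
nearly-balanced : {n r : ℕ} (G : Graph (Fin n)) {C : Fin r → Fin n → Set} (C? : ∀ a v → Dec (C a v)) →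
  (∀ {a a′ u v} → C a u → C a′ v → Adj G u v → a ≡ a′) →
  (∀ {a a′ v} → C a v → C a′ v → a ≡ a′) →
  {M E σ : ℕ} → 1 ≤ r → (∀ a → ∑[ v < n ] ⟦ C? a v ⟧ ≤ M) →
  n ≤ ∑[ a < r ] ∑[ v < n ] ⟦ C? a v ⟧ + σ → r * M ≤ n + E →
  ∃ λ (B : BalancedSeparation r G) → ∣ separator B ∣ ≤ r * σ + r * E
nearly-balanced {n} {r@(suc k)} G C? no-edge disj {M} {E} {σ} _ cell≤M n≤ rM≤ =
  B , +-cancelʳ-≤ (k * n + r * m) _ _ (begin
    s + (k * n + r * m)                     ≡⟨ shuffle s (k * n) (r * m) ⟩
    (s + r * m) + k * n                     ≤⟨ +-monoˡ-≤ (k * n) (proj₂ equal) ⟩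
    r * n                                   ≤⟨ *-monoʳ-≤ r (m≤n+m∸n n (σ + k * M)) ⟩
    r * (σ + k * M + m)                     ≡⟨ expand k σ M m ⟩
    (r * σ + r * m) + k * (r * M)           ≤⟨ +-monoʳ-≤ (r * σ + r * m) (*-monoʳ-≤ k rM≤) ⟩
    (r * σ + r * m) + k * (n + E)           ≤⟨ m≤m+n _ E ⟩
    (r * σ + r * m) + k * (n + E) + E       ≡⟨ collect k n σ m E ⟩
    (r * σ + r * E) + (k * n + r * m)       ∎)
  where
  open ≤-Reasoning
  -- If this subtraction truncates, `m` is 0 and the estimate above survives, as it uses only
  -- `n ≤ σ + k * M + m`.
  m = n ∸ (σ + k * M)
  m≤cell : ∀ a → m ≤ ∑[ v < n ] ⟦ C? a v ⟧
  m≤cell a = ≤-trans (ℕ.∸-monoˡ-≤ (σ + k * M) (≤-trans n≤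
      (≤-trans (+-monoˡ-≤ σ (∑≤term+max _ cell≤M a)) (≤-reflexive (regroup _ (k * M) σ)))))
      (≤-reflexive (ℕ.m+n∸n≡m _ (σ + k * M)))
    where
    regroup : ∀ x y z → x + y + z ≡ x + (z + y)
    regroup = solve-∀
  equal = equalise G C? no-edge disj m m≤cell
  B = proj₁ equal
  s = ∣ separator B ∣
  shuffle : ∀ s x y → s + (x + y) ≡ (s + y) + x
  shuffle = solve-∀
  expand : ∀ k σ M m → suc k * (σ + k * M + m) ≡ (suc k * σ + suc k * m) + k * (suc k * M)
  expand = solve-∀
  collect : ∀ k n σ m E → (suc k * σ + suc k * m) + k * (n + E) + E ≡ (suc k * σ + suc k * E) + (k * n + suc k * m)
  collect = solve-∀

-- Distribution of the paths and cycles among the cells.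

data Label (r : ℕ) : Set where
  fresh cut : Label r
  cell      : Fin r → Label r

cell-injective : {r : ℕ} {a a′ : Fin r} → cell a ≡ cell a′ → a ≡ a′
cell-injective refl = refl

_≟ₗ_ : {r : ℕ} (l l′ : Label r) → Dec (l ≡ l′)
fresh  ≟ₗ fresh   = yes refl
fresh  ≟ₗ cut     = no λ ()
fresh  ≟ₗ cell _  = no λ ()
cut    ≟ₗ fresh   = no λ ()
cut    ≟ₗ cut     = yes refl
cut    ≟ₗ cell _  = no λ ()
cell _ ≟ₗ fresh   = no λ ()
cell _ ≟ₗ cut     = no λ ()
cell a ≟ₗ cell a′ with a ≟ a′
... | yes refl = yes refl
... | no a≢a′  = no (a≢a′ ∘ cell-injective)

count : {n r : ℕ} → Label r → (Fin n → Label r) → ℕ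
count {n} l lab = ∑[ v < n ] ⟦ lab v ≟ₗ l ⟧

module Greedy {n r : ℕ} (h : Fin r → Fin n → Fin n) (q : ℕ) where

  open Classes h
  open Special h q

  -- A cell counts as full with `m + 3` vertices, so that `m + 1` remain after two are cut, and by
  -- `room` not all `r` cells can be full. A cell that is not full has at most `m + 2` vertices and
  -- receives at most `P` with the next class, whence `M-large`.
  module Filling (m P M σ : ℕ)
         (1≤d : ∀ v → 1 ≤ d v)
         (light : ∀ {i x} → Act i x → ¬ Special i x → size i x ≤ P)
         (room : n < r * suc m)
         (M-large : m + 2 + P ≤ M) where

    -- The classes are used up one after the other, the vertices of a class going to cell j until
    -- that cell is full.  A labelled vertex that still shares a class with a fresh one is left or
    -- right, and lies in cell j: cutting these two vertices makes the next cell available.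
    record State (j : ℕ) : Set where
      field
        lab        : Fin n → Label r
        left right : Fin n
        cut-ok     : ∀ {v} → Cut v → lab v ≡ cut
        fresh-ok   : ∀ {v} → lab v ≡ fresh → ∀ i → ¬ Special i (h i v)
        done       : ∀ {v a} → lab v ≡ cell a →
                     ∃ λ i → Act i (h i v) × (∀ u → h i u ≡ h i v → lab u ≢ fresh)
        agree      : ∀ {u v a a′} → lab u ≡ cell a → lab v ≡ cell a′ → ∀ i → h i u ≡ h i v → a ≡ a′
        open-ok    : ∀ {u v a} → lab v ≡ cell a → lab u ≡ fresh → ∀ i → h i u ≡ h i v →
                     (v ≡ left ⊎ v ≡ right) × toℕ a ≡ j
        cells≤     : ∀ a → count (cell a) lab ≤ M
        cells≥     : ∀ a → toℕ a < j → suc m ≤ count (cell a) lab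
        cuts≤      : count cut lab ≤ σ + 2 * j

    open State

    swap : ∀ {j} → State j → State j
    swap S = record
      { lab = lab S; left = right S; right = left S
      ; cut-ok = cut-ok S; fresh-ok = fresh-ok S; done = done S; agree = agree S
      ; open-ok = λ v-cell u-fresh i eq → let ends , ≡j = open-ok S v-cell u-fresh i eq
                                          in  [ inj₂ , inj₁ ]′ ends , ≡j
      ; cells≤ = cells≤ S; cells≥ = cells≥ S; cuts≤ = cuts≤ S }

    module _ {j : ℕ} (S : State j) (c : Fin r) (c≡j : toℕ c ≡ j) where

      private
        -- Since `left` and `right` always name some vertices, an end is cut only if it lies in cell
        -- `c`. Thus no other cell loses a vertex.
        Out? : ∀ v → Dec (((v ≡ left S) ⊎ (v ≡ right S)) × lab S v ≡ cell c)
        Out? v = ((v ≟ left S) ⊎-dec (v ≟ right S)) ×-dec (lab S v ≟ₗ cell c)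

        new : Fin n → Label r
        new v = if does (Out? v) then cut else lab S v

        new-cases : ∀ v → (((v ≡ left S ⊎ v ≡ right S) × lab S v ≡ cell c) × new v ≡ cut) ⊎
                          (¬ ((v ≡ left S ⊎ v ≡ right S) × lab S v ≡ cell c) × new v ≡ lab S v)
        new-cases v = go (Out? v)
          where
          go : {P : Set} (P? : Dec P) →
               (P × (if does P? then cut else lab S v) ≡ cut) ⊎
               (¬ P × (if does P? then cut else lab S v) ≡ lab S v)
          go (yes p) = inj₁ (p , refl)
          go (no ¬p) = inj₂ (¬p , refl)

        new-fresh : ∀ {v} → new v ≡ fresh → lab S v ≡ fresh
        new-fresh {v} eq with new-cases v
        ... | inj₁ (_ , ≡cut) = case trans (sym eq) ≡cut of λ ()
        ... | inj₂ (_ , ≡old) = trans (sym ≡old) eq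

        new-cell : ∀ {v a} → new v ≡ cell a →
                   lab S v ≡ cell a × ¬ ((v ≡ left S ⊎ v ≡ right S) × lab S v ≡ cell c)
        new-cell {v} eq with new-cases v
        ... | inj₁ (_ , ≡cut)  = case trans (sym eq) ≡cut of λ ()
        ... | inj₂ (¬o , ≡old) = trans (sym ≡old) eq , ¬o

        ends : Fin n → ℕ
        ends v = ⟦ left S ≟ v ⟧ * 1 + ⟦ right S ≟ v ⟧ * 1

        ∑ends : sum ends ≡ 2
        ∑ends = trans (∑-distrib-+ (λ v → ⟦ left S ≟ v ⟧ * 1) (λ v → ⟦ right S ≟ v ⟧ * 1))
                      (cong₂ _+_ (sum-point (λ _ → 1) (left S)) (sum-point (λ _ → 1) (right S)))

        1≤ends : ∀ {v} → v ≡ left S ⊎ v ≡ right S → 1 ≤ ends v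
        1≤ends {v} (inj₁ refl) = ≤-trans (≤-reflexive (sym (trans (ℕ.*-identityʳ _) (⟦⟧-yes (v ≟ v) refl)))) (m≤m+n _ _)
        1≤ends {v} (inj₂ refl) = ≤-trans (≤-reflexive (sym (trans (ℕ.*-identityʳ _) (⟦⟧-yes (v ≟ v) refl)))) (m≤n+m _ (⟦ left S ≟ v ⟧ * 1))

        count-ends : (f g : Fin n → ℕ) → (∀ v → f v ≤ g v + ends v) → sum f ≤ sum g + 2
        count-ends f g f≤ = ≤-trans (sum-mono f≤)
          (≤-reflexive (trans (∑-distrib-+ g ends) (cong (sum g +_) ∑ends)))

      -- By `open-ok` the only vertices in cells that share a class with a fresh one are ends in
      -- cell `c`. Once these are cut, nothing ties the fresh vertices to cell `c`, and the next
      -- cell can be started.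
      switch : suc m + 2 ≤ count (cell c) (lab S) → State (suc j)
      switch full = record
        { lab = new ; left = left S ; right = right S
        ; cut-ok = new-cut
        ; fresh-ok = λ v-fresh → fresh-ok S (new-fresh v-fresh)
        ; done = λ v-cell → let i , a , nonfresh = done S (proj₁ (new-cell v-cell))
                            in  i , a , λ u eq u-fresh → nonfresh u eq (new-fresh u-fresh)
        ; agree = λ u-cell v-cell → agree S (proj₁ (new-cell u-cell)) (proj₁ (new-cell v-cell))
        ; open-ok = λ v-cell u-fresh i eq → contradiction v-cell (not-open v-cell u-fresh i eq)
        ; cells≤ = λ a → ≤-trans (sum-mono λ v → ⟦⟧-mono (new v ≟ₗ cell a) (lab S v ≟ₗ cell a) (proj₁ ∘ new-cell)) (cells≤ S a)
        ; cells≥ = cells-full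
        ; cuts≤ = ≤-trans (count-ends _ _ cut≤)
                  (≤-trans (+-monoˡ-≤ 2 (cuts≤ S)) (≤-reflexive (arith σ j))) }
        where
        arith : ∀ s j → s + 2 * j + 2 ≡ s + 2 * suc j
        arith = solve-∀
        new-cut : ∀ {v} → Cut v → new v ≡ cut
        new-cut {v} v-cut with new-cases v
        ... | inj₁ (_ , ≡cut) = ≡cut
        ... | inj₂ (_ , ≡old) = trans ≡old (cut-ok S v-cut)
        not-open : ∀ {u v a} → new v ≡ cell a → new u ≡ fresh → ∀ i → h i u ≡ h i v → new v ≢ cell a
        not-open v-cell u-fresh i eq _ =
          let v-cell′ , stays = new-cell v-cell
              at-end , ≡j     = open-ok S v-cell′ (new-fresh u-fresh) i eq
          in  stays (at-end , trans v-cell′ (cong cell (Fin.toℕ-injective (trans ≡j (sym c≡j)))))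
        cut≤ : ∀ v → ⟦ new v ≟ₗ cut ⟧ ≤ ⟦ lab S v ≟ₗ cut ⟧ + ends v
        cut≤ v = ⟦⟧-≤ (new v ≟ₗ cut) go
          where
          go : new v ≡ cut → 1 ≤ ⟦ lab S v ≟ₗ cut ⟧ + ends v
          go ≡cut with new-cases v
          ... | inj₁ ((at-end , _) , _) = ≤-trans (1≤ends at-end) (m≤n+m (ends v) ⟦ lab S v ≟ₗ cut ⟧)
          ... | inj₂ (_ , ≡old) = ≤-trans (≤-reflexive (sym (⟦⟧-yes (lab S v ≟ₗ cut) (trans (sym ≡old) ≡cut)))) (m≤m+n _ _)
        cells-full : ∀ a → toℕ a < suc j → suc m ≤ count (cell a) new
        cells-full a a<sj with a ≟ c
        ... | yes refl = +-cancelʳ-≤ 2 _ _ (≤-trans full (count-ends _ _ cell≤))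
          where
          cell≤ : ∀ v → ⟦ lab S v ≟ₗ cell a ⟧ ≤ ⟦ new v ≟ₗ cell a ⟧ + ends v
          cell≤ v = ⟦⟧-≤ (lab S v ≟ₗ cell a) go
            where
            go : lab S v ≡ cell a → 1 ≤ ⟦ new v ≟ₗ cell a ⟧ + ends v
            go ≡cell with new-cases v
            ... | inj₁ ((at-end , _) , _) = ≤-trans (1≤ends at-end) (m≤n+m (ends v) ⟦ new v ≟ₗ cell a ⟧)
            ... | inj₂ (_ , ≡old) = ≤-trans (≤-reflexive (sym (⟦⟧-yes (new v ≟ₗ cell a) (trans ≡old ≡cell)))) (m≤m+n _ _)
        ... | no a≢c = ≤-trans (cells≥ S a a<j) (sum-mono λ v → ⟦⟧-mono (lab S v ≟ₗ cell a) (new v ≟ₗ cell a) (keep v))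
          where
          a<j : toℕ a < j
          a<j = ℕ.≤∧≢⇒< (ℕ.≤-pred a<sj) (λ a≡j → a≢c (Fin.toℕ-injective (trans a≡j (sym c≡j))))
          keep : ∀ v → lab S v ≡ cell a → new v ≡ cell a
          keep v ≡cell with new-cases v
          ... | inj₁ ((_ , ≡c) , _) = contradiction (cell-injective (trans (sym ≡cell) ≡c)) a≢c
          ... | inj₂ (_ , ≡old) = trans ≡old ≡cell

      switch-fresh : (full : suc m + 2 ≤ count (cell c) (lab S)) → count fresh (lab (switch full)) ≤ count fresh (lab S)
      switch-fresh _ = sum-mono λ v → ⟦⟧-mono (new v ≟ₗ fresh) (lab S v ≟ₗ fresh) new-fresh

      private
        fill : {P : Set} → Label r → Dec P → Label r
        fill fresh    (yes _) = cell c
        fill fresh    (no _)  = fresh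
        fill cut      _       = cut
        fill (cell a) _       = cell a

        fill-fresh : {P : Set} (l : Label r) (P? : Dec P) → fill l P? ≡ fresh → l ≡ fresh × ¬ P
        fill-fresh fresh    (no ¬p) _ = refl , ¬p
        fill-fresh fresh    (yes _) ()
        fill-fresh cut      _ ()
        fill-fresh (cell _) _ ()

        fill-cell : {P : Set} (l : Label r) (P? : Dec P) {a : Fin r} → fill l P? ≡ cell a →
                    l ≡ cell a ⊎ (l ≡ fresh × P × a ≡ c)
        fill-cell fresh    (yes p) refl = inj₂ (refl , p , refl)
        fill-cell fresh    (no _)  ()
        fill-cell cut      _ ()
        fill-cell (cell _) _ refl = inj₁ refl

        fill-cut : {P : Set} (l : Label r) (P? : Dec P) → fill l P? ≡ cut → l ≡ cut
        fill-cut fresh    (yes _) ()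
        fill-cut fresh    (no _)  ()
        fill-cut cut      _ _ = refl
        fill-cut (cell _) _ ()

        fill-keeps-cut : {P : Set} (l : Label r) (P? : Dec P) → l ≡ cut → fill l P? ≡ cut
        fill-keeps-cut _ _ refl = refl

        fill-keeps-cell : {P : Set} (l : Label r) (P? : Dec P) {a : Fin r} → l ≡ cell a → fill l P? ≡ cell a
        fill-keeps-cell _ _ refl = refl

      -- One step of the distribution: the fresh vertices of the class K represented by `X` go to
      -- cell `c`. The two hypotheses on the new ends say that they include the fresh vertices of K
      -- with degree at least 2, and all previously open vertices outside K.
      module _ (i : Fin r) (X : Fin n) (K-act : Act i X)
               {u : Fin n} (u-fresh : lab S u ≡ fresh) (u∈K : h i u ≡ X)
               (left′ right′ : Fin n)
               (fresh-ends : ∀ {v} → lab S v ≡ fresh → h i v ≡ X → 2 ≤ d v → v ≡ left′ ⊎ v ≡ right′)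
               (open-ends : ∀ {v a} z k → lab S v ≡ cell a → lab S z ≡ fresh → h k z ≡ h k v →
                            h i v ≡ X ⊎ (v ≡ left′ ⊎ v ≡ right′))
               (not-full : count (cell c) (lab S) ≤ m + 2) where

        private
          filled : Fin n → Label r
          filled v = fill (lab S v) (h i v ≟ X)

          filled-fresh : ∀ {v} → filled v ≡ fresh → lab S v ≡ fresh × h i v ≢ X
          filled-fresh {v} = fill-fresh (lab S v) (h i v ≟ X)

          filled-cell : ∀ {v a} → filled v ≡ cell a → lab S v ≡ cell a ⊎ (lab S v ≡ fresh × h i v ≡ X × a ≡ c)
          filled-cell {v} = fill-cell (lab S v) (h i v ≟ X)

          size≤ : size i X ≤ P
          size≤ = light K-act (λ s → fresh-ok S u-fresh i (subst (Special i) (sym u∈K) s))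

          -- A newly placed vertex that shares another class with a fresh one has degree at least 2,
          -- so `fresh-ends` applies. An old vertex of K cannot stay open: K, the class without
          -- fresh vertices given by `done`, and the class shared with `z` would have three
          -- different colours, and a vertex of degree 3 is cut.
          filled-open : ∀ {z v a} → filled v ≡ cell a → filled z ≡ fresh → ∀ k → h k z ≡ h k v →
                        (v ≡ left′ ⊎ v ≡ right′) × toℕ a ≡ j
          filled-open {z} {v} v-cell z-fresh k eq with filled-fresh z-fresh | filled-cell v-cell
          ... | z-fresh′ , z∉K | inj₂ (v-fresh , v∈K , refl) =
            fresh-ends v-fresh v∈K (act₂⇒2≤d (λ { refl → z∉K (trans eq v∈K) }) (subst (Act i) (sym v∈K) K-act)
              (shared⇒act k (sym eq) (λ { refl → z∉K v∈K }))) , c≡j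
          ... | z-fresh′ , z∉K | inj₁ v-cell′ with open-ends z k v-cell′ z-fresh′ eq
          ... | inj₂ at-end = at-end , proj₂ (open-ok S v-cell′ z-fresh′ k eq)
          ... | inj₁ v∈K with done S v-cell′
          ... | k₀ , a₀ , nonfresh = contradiction (trans (sym v-cell′) (cut-ok S (inj₁ 3≤d))) λ ()
            where
            3≤d : 3 ≤ d v
            3≤d = act₃⇒3≤d {i = k₀} {j = i} {k = k}
              (λ { refl → nonfresh u (trans u∈K (sym v∈K)) u-fresh })
              (λ { refl → nonfresh z eq z-fresh′ })
              (λ { refl → z∉K (trans eq v∈K) })
              a₀ (subst (Act i) (sym v∈K) K-act)
              (shared⇒act k (sym eq) (λ { refl → z∉K v∈K }))

          -- An old vertex sharing a class with one that was fresh was open, so by `open-ok` it lies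
          -- in the current cell `c`, where the other one has just been put.
          filled-agree : ∀ {z v a a′} → filled z ≡ cell a → filled v ≡ cell a′ → ∀ k → h k z ≡ h k v → a ≡ a′
          filled-agree z-cell v-cell k eq with filled-cell z-cell | filled-cell v-cell
          ... | inj₁ z-old | inj₁ v-old = agree S z-old v-old k eq
          ... | inj₁ z-old | inj₂ (v-fresh , _ , refl) =
            Fin.toℕ-injective (trans (proj₂ (open-ok S z-old v-fresh k (sym eq))) (sym c≡j))
          ... | inj₂ (z-fresh , _ , refl) | inj₁ v-old =
            Fin.toℕ-injective (trans c≡j (sym (proj₂ (open-ok S v-old z-fresh k eq))))
          ... | inj₂ (_ , _ , refl) | inj₂ (_ , _ , refl) = refl

          filled-done : ∀ {v a} → filled v ≡ cell a → ∃ λ k → Act k (h k v) × (∀ z → h k z ≡ h k v → filled z ≢ fresh)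
          filled-done v-cell with filled-cell v-cell
          ... | inj₂ (_ , v∈K , _) = i , subst (Act i) (sym v∈K) K-act ,
            λ z eq z-fresh → proj₂ (filled-fresh z-fresh) (trans eq v∈K)
          ... | inj₁ v-old with done S v-old
          ... | k , a , nonfresh = k , a , λ z eq z-fresh → nonfresh z eq (proj₁ (filled-fresh z-fresh))

          filled-cells≤ : ∀ a → count (cell a) filled ≤ M
          filled-cells≤ a with a ≟ c
          ... | yes refl = begin
            count (cell a) filled
              ≤⟨ sum-mono (λ v → ⟦⟧-≤ (filled v ≟ₗ cell a) (old-or-K v)) ⟩
            ∑[ v < n ] (⟦ lab S v ≟ₗ cell a ⟧ + ⟦ h i v ≟ X ⟧)
              ≡⟨ ∑-distrib-+ (λ v → ⟦ lab S v ≟ₗ cell a ⟧) (λ v → ⟦ h i v ≟ X ⟧) ⟩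
            count (cell a) (lab S) + size i X
              ≤⟨ +-mono-≤ not-full size≤ ⟩
            m + 2 + P
              ≤⟨ M-large ⟩
            M ∎
            where
            open ≤-Reasoning
            old-or-K : ∀ v → filled v ≡ cell a → 1 ≤ ⟦ lab S v ≟ₗ cell a ⟧ + ⟦ h i v ≟ X ⟧
            old-or-K v v-cell with filled-cell v-cell
            ... | inj₁ v-old = ≤-trans (≤-reflexive (sym (⟦⟧-yes (lab S v ≟ₗ cell a) v-old))) (m≤m+n _ _)
            ... | inj₂ (_ , v∈K , _) = ≤-trans (≤-reflexive (sym (⟦⟧-yes (h i v ≟ X) v∈K))) (m≤n+m _ _)
          ... | no a≢c = ≤-trans (sum-mono λ v → ⟦⟧-mono (filled v ≟ₗ cell a) (lab S v ≟ₗ cell a) (old v)) (cells≤ S a)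
            where
            old : ∀ v → filled v ≡ cell a → lab S v ≡ cell a
            old v v-cell with filled-cell v-cell
            ... | inj₁ v-old = v-old
            ... | inj₂ (_ , _ , a≡c) = contradiction a≡c a≢c

        step : State j
        step = record
          { lab = filled ; left = left′ ; right = right′
          ; cut-ok = λ {v} v-cut → fill-keeps-cut (lab S v) (h i v ≟ X) (cut-ok S v-cut)
          ; fresh-ok = λ v-fresh → fresh-ok S (proj₁ (filled-fresh v-fresh))
          ; done = filled-done
          ; agree = filled-agree
          ; open-ok = filled-open
          ; cells≤ = filled-cells≤
          ; cells≥ = λ a a<j → ≤-trans (cells≥ S a a<j) (sum-mono λ v →
              ⟦⟧-mono (lab S v ≟ₗ cell a) (filled v ≟ₗ cell a) (fill-keeps-cell (lab S v) (h i v ≟ X)))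
          ; cuts≤ = ≤-trans (sum-mono λ v → ⟦⟧-mono (filled v ≟ₗ cut) (lab S v ≟ₗ cut) (fill-cut (lab S v) (h i v ≟ X))) (cuts≤ S) }

        step-progress : count fresh filled < count fresh (lab S)
        step-progress = sum-mono-<
          (λ v → ⟦⟧-mono (filled v ≟ₗ fresh) (lab S v ≟ₗ fresh) (proj₁ ∘ filled-fresh)) u
          (≤-reflexive (trans (cong suc (⟦⟧-no (filled u ≟ₗ fresh) (λ eq → proj₂ (filled-fresh eq) u∈K)))
                              (sym (⟦⟧-yes (lab S u ≟ₗ fresh) u-fresh))))

    private
      -- A class that is not special has `b ≤ 2`, so apart from `x` it has at most one vertex of
      -- degree at least 2. If there is none, `x` itself is returned as the default.
      two-ends : ∀ {i X} → Act i X → ¬ Special i X → ∀ {x} → h i x ≡ X → 2 ≤ d x →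
                 ∃ λ z → ∀ {v} → h i v ≡ X → 2 ≤ d v → v ≡ x ⊎ v ≡ z
      two-ends {i} {X} a ¬s {x} x∈K 2≤dx with any? (λ z → ¬? (z ≟ x) ×-dec ((h i z ≟ X) ×-dec (2 ≤? d z)))
      ... | no  ∄z = x , only
        where
        only : ∀ {v} → h i v ≡ X → 2 ≤ d v → v ≡ x ⊎ v ≡ x
        only {v} v∈K 2≤dv with v ≟ x
        ... | yes v≡x = inj₁ v≡x
        ... | no  v≢x = contradiction (v , v≢x , v∈K , 2≤dv) ∄z
      ... | yes (z , z≢x , z∈K , 2≤dz) = z , only
        where
        one : ∀ {v} → h i v ≡ X → 2 ≤ d v → 1 ≤ ⟦ h i v ≟ X ⟧ * w v
        one {v} v∈K 2≤dv = ≤-reflexive (sym (cong₂ _*_ (⟦⟧-yes (h i v ≟ X) v∈K) (⟦⟧-yes (2 ≤? d v) 2≤dv)))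
        only : ∀ {v} → h i v ≡ X → 2 ≤ d v → v ≡ x ⊎ v ≡ z
        only {v} v∈K 2≤dv with v ≟ x | v ≟ z
        ... | yes v≡x | _       = inj₁ v≡x
        ... | no _    | yes v≡z = inj₂ v≡z
        ... | no v≢x  | no v≢z  = contradiction (a , inj₁ (≤-trans
          (+-mono-≤ (one v∈K 2≤dv) (+-mono-≤ (one x∈K 2≤dx) (one z∈K 2≤dz)))
          (three-terms≤sum (λ v → ⟦ h i v ≟ X ⟧ * w v) v≢x v≢z (z≢x ∘ sym)))) ¬s

      Open : ∀ {j} → State j → Fin n → Set
      Open S x = ∃ λ a → lab S x ≡ cell a × ∃₂ λ u i → lab S u ≡ fresh × h i u ≡ h i x

      Open? : ∀ {j} (S : State j) x → Dec (Open S x)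
      Open? S x = any? λ a → (lab S x ≟ₗ cell a) ×-dec any? λ u → any? λ i →
                    (lab S u ≟ₗ fresh) ×-dec (h i u ≟ h i x)

      Advance : ∀ {j} → State j → Set
      Advance {j} S = Σ[ S′ ∈ State j ] count fresh (lab S′) < count fresh (lab S)

      -- Continues the current path beyond its end `x`. The class given by `done` for `x` has no
      -- fresh vertex and hence differs from K, so `x` is one of the at most two vertices of W in K;
      -- the other one, `z`, replaces `x` as an end.
      advance-open : ∀ {j} (S : State j) (c : Fin r) → toℕ c ≡ j → count (cell c) (lab S) ≤ m + 2 →
                     Open S (left S) → Advance S
      advance-open S c c≡j not-full (a , x-cell , u , i , u-fresh , u∈K) =
        step S c c≡j i (h i x) K-act u-fresh u∈K z (right S) fresh-ends open-ends not-full ,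
        step-progress S c c≡j i (h i x) K-act u-fresh u∈K z (right S) fresh-ends open-ends not-full
        where
        x = left S
        x≢ : ∀ {v} → lab S v ≡ fresh → x ≢ v
        x≢ v-fresh refl = case trans (sym x-cell) v-fresh of λ ()
        K-act : Act i (h i x)
        K-act = shared⇒act i (sym u∈K) (x≢ u-fresh)
        2≤dx : 2 ≤ d x
        2≤dx with done S x-cell
        ... | k , a , nonfresh = act₂⇒2≤d (λ { refl → nonfresh u u∈K u-fresh }) a K-act
        boundary = two-ends K-act (λ s → fresh-ok S u-fresh i (subst (Special i) (sym u∈K) s)) refl 2≤dx
        z = proj₁ boundary
        fresh-ends : ∀ {v} → lab S v ≡ fresh → h i v ≡ h i x → 2 ≤ d v → v ≡ z ⊎ v ≡ right S
        fresh-ends v-fresh v∈K 2≤dv with proj₂ boundary v∈K 2≤dv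
        ... | inj₁ v≡x = contradiction (sym v≡x) (x≢ v-fresh)
        ... | inj₂ v≡z = inj₁ v≡z
        open-ends : ∀ {v a} y k → lab S v ≡ cell a → lab S y ≡ fresh → h k y ≡ h k v →
                    h i v ≡ h i x ⊎ (v ≡ z ⊎ v ≡ right S)
        open-ends y k v-cell y-fresh eq with proj₁ (open-ok S v-cell y-fresh k eq)
        ... | inj₁ refl = inj₁ refl
        ... | inj₂ v≡r  = inj₂ (inj₂ v≡r)

      -- With neither end open, the current path or cycle is exhausted. A new one is begun at any
      -- nontrivial class of `u`, whose vertices in W become the two ends.
      advance-closed : ∀ {j} (S : State j) (c : Fin r) → toℕ c ≡ j → count (cell c) (lab S) ≤ m + 2 →
                       ¬ Open S (left S) → ¬ Open S (right S) → ∀ {u} → lab S u ≡ fresh → Advance S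
      advance-closed S c c≡j not-full left-closed right-closed {u} u-fresh =
        step S c c≡j i (h i u) K-act u-fresh refl y z fresh-ends open-ends not-full ,
        step-progress S c c≡j i (h i u) K-act u-fresh refl y z fresh-ends open-ends not-full
        where
        i = proj₁ (1≤d⇒act (1≤d u))
        K-act : Act i (h i u)
        K-act = proj₂ (1≤d⇒act (1≤d u))
        boundary : ∃₂ λ y z → ∀ {v} → h i v ≡ h i u → 2 ≤ d v → v ≡ y ⊎ v ≡ z
        boundary with any? (λ y → (h i y ≟ h i u) ×-dec (2 ≤? d y))
        -- Without vertices of degree at least 2 the class is a whole component by itself, and `u`
        -- stands in for both ends.
        ... | no  ∄y = u , u , λ v∈K 2≤dv → contradiction (_ , v∈K , 2≤dv) ∄y
        ... | yes (y , y∈K , 2≤dy) = y , two-ends K-act (fresh-ok S u-fresh i) y∈K 2≤dy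
        y = proj₁ boundary
        z = proj₁ (proj₂ boundary)
        fresh-ends : ∀ {v} → lab S v ≡ fresh → h i v ≡ h i u → 2 ≤ d v → v ≡ y ⊎ v ≡ z
        fresh-ends _ = proj₂ (proj₂ boundary)
        open-ends : ∀ {v a} x k → lab S v ≡ cell a → lab S x ≡ fresh → h k x ≡ h k v →
                    h i v ≡ h i u ⊎ (v ≡ y ⊎ v ≡ z)
        open-ends x k v-cell x-fresh eq with proj₁ (open-ok S v-cell x-fresh k eq)
        ... | inj₁ refl = contradiction (_ , v-cell , x , k , x-fresh , eq) left-closed
        ... | inj₂ refl = contradiction (_ , v-cell , x , k , x-fresh , eq) right-closed

      advance : ∀ {j} (S : State j) (c : Fin r) → toℕ c ≡ j → count (cell c) (lab S) ≤ m + 2 →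
                ∀ {u} → lab S u ≡ fresh → Advance S
      advance S c c≡j not-full u-fresh with Open? S (left S) | Open? S (right S)
      ... | yes o | _     = advance-open S c c≡j not-full o
      ... | no _  | yes o = advance-open (swap S) c c≡j not-full o
      ... | no ¬l | no ¬r = advance-closed S c c≡j not-full ¬l ¬r u-fresh

      not-all-full : (S : State r) → ⊥
      not-all-full S = ℕ.<⇒≱ room (begin
        r * suc m
          ≡⟨ sym (sum-const r (suc m)) ⟩
        ∑[ a < r ] suc m
          ≤⟨ sum-mono (λ a → cells≥ S a (Fin.toℕ<n a)) ⟩
        ∑[ a < r ] ∑[ v < n ] ⟦ lab S v ≟ₗ cell a ⟧
          ≡⟨ ∑-comm (λ a v → ⟦ lab S v ≟ₗ cell a ⟧) ⟩
        ∑[ v < n ] ∑[ a < r ] ⟦ lab S v ≟ₗ cell a ⟧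
          ≤⟨ sum-mono (λ v → ∑-unique (λ a → lab S v ≟ₗ cell a) (λ eq eq′ → cell-injective (trans (sym eq) eq′))) ⟩
        ∑[ v < n ] 1
          ≡⟨ trans (sum-const n 1) (ℕ.*-identityʳ n) ⟩
        n ∎)
        where open ≤-Reasoning

    Complete : Set
    Complete = ∃ λ j → j ≤ r × Σ[ S ∈ State j ] (∀ v → lab S v ≢ fresh)

    private
      next : ∀ {j k} → j + suc k ≡ r → Σ[ c ∈ Fin r ] toℕ c ≡ j
      next {j} {k} eq = fromℕ< j<r , Fin.toℕ-fromℕ< j<r
        where
        j<r : j < r
        j<r = ≤-trans (s≤s (m≤m+n j k)) (≤-reflexive (trans (sym (ℕ.+-suc j k)) eq))

    -- Lexicographic recursion: `k` is the number of cells not yet closed and drops with `switch`;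
    -- `fuel` bounds the number of fresh vertices and drops with `advance`.
    complete : ∀ k fuel {j} → j + k ≡ r → (S : State j) → count fresh (lab S) ≤ fuel → Complete
    complete k fuel {j} j+k≡r S ≤fuel with any? (λ v → lab S v ≟ₗ fresh)
    complete k fuel {j} j+k≡r S ≤fuel | no ∄fresh =
      j , ≤-trans (m≤m+n j k) (≤-reflexive j+k≡r) , S , λ v v-fresh → ∄fresh (v , v-fresh)
    complete zero fuel {j} j+k≡r S ≤fuel | yes _ =
      ⊥-elim (not-all-full (subst State (trans (sym (+-identityʳ j)) j+k≡r) S))
    complete (suc k) fuel {j} j+k≡r S ≤fuel | yes (u , u-fresh) with next j+k≡r
    ... | c , c≡j with suc m + 2 ≤? count (cell c) (lab S)
    complete (suc k) fuel {j} j+k≡r S ≤fuel | yes (u , u-fresh) | c , c≡j | yes full =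
      complete k fuel (trans (sym (ℕ.+-suc j k)) j+k≡r) (switch S c c≡j full)
        (≤-trans (switch-fresh S c c≡j full) ≤fuel)
    complete (suc k) zero {j} j+k≡r S ≤fuel | yes (u , u-fresh) | _ | no _ =
      contradiction (≤-trans (≤-reflexive (sym (⟦⟧-yes (lab S u ≟ₗ fresh) u-fresh)))
        (≤-trans (term≤sum (λ v → ⟦ lab S v ≟ₗ fresh ⟧) u) ≤fuel)) λ ()
    complete (suc k) (suc fuel) {j} j+k≡r S ≤fuel | yes (u , u-fresh) | c , c≡j | no not-full =
      let S′ , progress = advance S c c≡j (ℕ.≤-pred (≰⇒> not-full)) u-fresh
      in  complete (suc k) fuel j+k≡r S′ (ℕ.≤-pred (≤-trans progress ≤fuel))

    module _ (special≤ : ∀ i → ∑[ v < n ] ⟦ Special? i (h i v) ⟧ ≤ M)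
             (cut≤ : ∑[ v < n ] ⟦ Cut? v ⟧ ≤ σ) where

      private
        lab₀ : Fin n → Label r
        lab₀ v with Cut? v
        ... | yes _ = cut
        ... | no  _ with any? (λ i → Special? i (h i v))
        ... | yes (i , _) = cell i
        ... | no  _       = fresh

        lab₀-cut : ∀ {v} → Cut v → lab₀ v ≡ cut
        lab₀-cut {v} v-cut with Cut? v
        ... | yes _   = refl
        ... | no ¬cut = contradiction v-cut ¬cut

        lab₀-fresh : ∀ {v} → lab₀ v ≡ fresh → ∀ i → ¬ Special i (h i v)
        lab₀-fresh {v} eq with Cut? v
        lab₀-fresh {v} () | yes _
        ... | no _ with any? (λ i → Special? i (h i v))
        lab₀-fresh {v} () | no _ | yes _
        ... | no ∄s = λ i s → ∄s (i , s)

        lab₀-cell : ∀ {v a} → lab₀ v ≡ cell a → ¬ Cut v × Special a (h a v)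
        lab₀-cell {v} eq with Cut? v
        lab₀-cell {v} () | yes _
        ... | no ¬cut with any? (λ i → Special? i (h i v))
        lab₀-cell {v} refl | no ¬cut | yes (i , s) = ¬cut , s
        lab₀-cell {v} ()   | no _ | no _

        lab₀-cut⁻ : ∀ {v} → lab₀ v ≡ cut → Cut v
        lab₀-cut⁻ {v} eq with Cut? v
        ... | yes v-cut = v-cut
        ... | no _ with any? (λ i → Special? i (h i v))
        lab₀-cut⁻ {v} () | no _ | yes _
        lab₀-cut⁻ {v} () | no _ | no _

        -- A vertex of a special class that has degree at least 2 belongs to `Cut`. Those left in
        -- the cells have no other nontrivial class, so at the start different cells share no class
        -- and no vertex is open.
        only-class : ∀ {v a} → lab₀ v ≡ cell a → ∀ {k} → Act k (h k v) → k ≡ a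
        only-class {v} {a} v-cell {k} act with k ≟ a
        ... | yes k≡a = k≡a
        ... | no  k≢a = let ¬cut , s = lab₀-cell v-cell
                        in  contradiction (inj₂ (act₂⇒2≤d k≢a act (proj₁ s) , a , s)) ¬cut

        agree₀ : ∀ {u v a a′} → lab₀ u ≡ cell a → lab₀ v ≡ cell a′ → ∀ i → h i u ≡ h i v → a ≡ a′
        agree₀ {u} {v} u-cell v-cell i eq with u ≟ v
        ... | yes refl = cell-injective (trans (sym u-cell) v-cell)
        ... | no  u≢v  = trans (sym (only-class u-cell (shared⇒act i eq u≢v)))
                               (only-class v-cell (shared⇒act i (sym eq) (u≢v ∘ sym)))

        not-open₀ : ∀ {u v a} → lab₀ v ≡ cell a → lab₀ u ≡ fresh → ∀ i → h i u ≢ h i v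
        not-open₀ {u} {v} v-cell u-fresh i eq
          with only-class v-cell (shared⇒act i (sym eq) (λ { refl → case trans (sym v-cell) u-fresh of λ () }))
        ... | refl = lab₀-fresh u-fresh i (subst (Special i) (sym eq) (proj₂ (lab₀-cell v-cell)))

        initial : Fin n → State 0
        initial x = record
          { lab = lab₀ ; left = x ; right = x
          ; cut-ok = lab₀-cut
          ; fresh-ok = lab₀-fresh
          ; done = λ {v} {a} v-cell → a , proj₁ (proj₂ (lab₀-cell v-cell)) , λ u eq u-fresh → not-open₀ v-cell u-fresh a eq
          ; agree = agree₀
          ; open-ok = λ v-cell u-fresh i eq → contradiction eq (not-open₀ v-cell u-fresh i)
          ; cells≤ = λ a → ≤-trans (sum-mono λ v → ⟦⟧-mono (lab₀ v ≟ₗ cell a) (Special? a (h a v)) (proj₂ ∘ lab₀-cell)) (special≤ a)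
          ; cells≥ = λ _ ()
          ; cuts≤ = ≤-trans (sum-mono λ v → ⟦⟧-mono (lab₀ v ≟ₗ cut) (Cut? v) lab₀-cut⁻)
                    (≤-trans cut≤ (m≤m+n σ _)) }

      -- The two ends of an edge share a class, so `agree` excludes edges between cells. Outside the
      -- cells lie at most `σ` vertices from the start and two for each cell closed.
      separation : (G : Graph (Fin n)) → (∀ {u v} → Adj G u v → ∃ λ i → h i u ≡ h i v) →
                   Fin n → {E : ℕ} → 1 ≤ r → r * M ≤ n + E →
                   ∃ λ (B : BalancedSeparation r G) → ∣ separator B ∣ ≤ r * (σ + 2 * r) + r * E
      separation G cover x 1≤r rM≤ with complete r (count fresh lab₀) {0} refl (initial x) ≤-refl
      ... | j , j≤r , S , none-fresh =
        nearly-balanced G (λ a v → lab S v ≟ₗ cell a)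
          (λ u-cell v-cell uv → agree S u-cell v-cell (proj₁ (cover uv)) (proj₂ (cover uv)))
          (λ eq eq′ → cell-injective (trans (sym eq) eq′))
          1≤r (cells≤ S)
          (≤-trans all (+-monoʳ-≤ (∑[ a < r ] count (cell a) (lab S)) (≤-trans (cuts≤ S) (+-monoʳ-≤ σ (*-monoʳ-≤ 2 j≤r)))))
          rM≤
        where
        open ≤-Reasoning
        labelled : ∀ v → 1 ≤ ∑[ a < r ] ⟦ lab S v ≟ₗ cell a ⟧ + ⟦ lab S v ≟ₗ cut ⟧
        labelled v with lab S v in eq
        ... | fresh  = contradiction eq (none-fresh v)
        ... | cut    = m≤n+m 1 _
        ... | cell a = ≤-trans (≤-reflexive (sym (⟦⟧-yes (cell a ≟ₗ cell a) refl)))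
                       (≤-trans (term≤sum (λ a′ → ⟦ cell a ≟ₗ cell a′ ⟧) a) (m≤m+n _ 0))
        all : n ≤ ∑[ a < r ] count (cell a) (lab S) + count cut (lab S)
        all = begin
          n
            ≡⟨ sym (trans (sum-const n 1) (ℕ.*-identityʳ n)) ⟩
          ∑[ v < n ] 1
            ≤⟨ sum-mono labelled ⟩
          ∑[ v < n ] (∑[ a < r ] ⟦ lab S v ≟ₗ cell a ⟧ + ⟦ lab S v ≟ₗ cut ⟧)
            ≡⟨ ∑-distrib-+ (λ v → ∑[ a < r ] ⟦ lab S v ≟ₗ cell a ⟧) (λ v → ⟦ lab S v ≟ₗ cut ⟧) ⟩
          ∑[ v < n ] ∑[ a < r ] ⟦ lab S v ≟ₗ cell a ⟧ + count cut (lab S)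
            ≡⟨ cong (_+ count cut (lab S)) (∑-comm (λ v a → ⟦ lab S v ≟ₗ cell a ⟧)) ⟩
          ∑[ a < r ] count (cell a) (lab S) + count cut (lab S) ∎

-- Use of the connectivity of the graph.

-Connected⇒Connected : {n k : ℕ} {G : Graph (Fin n)} → 1 ≤ k → k -Connected G → Connected G
-Connected⇒Connected {n} 1≤k (_ , conn) u v =
  gmap proj₁ id (conn ⊥ₛ (≤-trans (s≤s (≤-reflexive (∣⊥∣≡0 n))) 1≤k) (u , ∉⊥) (v , ∉⊥))

neighbour : {n : ℕ} {G : Graph (Fin n)} → 2 ≤ n → Connected G → ∀ v → ∃ λ u → Adj G v u
neighbour {suc (suc n)} {G} _ conn v = go (conn v (punchIn v zero)) (Fin.punchInᵢ≢i v zero ∘ sym)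
  where
  go : ∀ {z} → Star (Adj G) v z → v ≢ z → ∃ λ u → Adj G v u
  go ε       v≢v = contradiction refl v≢v
  go (e ◅ _) _   = _ , e
neighbour {suc zero} (s≤s ())

Adj⇒≢ : {V : Set} (G : Graph V) {u v : V} → Adj G u v → u ≢ v
Adj⇒≢ G {u} uv refl = subst T (adj-irrefl G u) uv

module Separation {n r : ℕ} (G : Graph (Fin n)) (h : Fin r → Fin n → Fin n)
         (idem : ∀ i v → h i (h i v) ≡ h i v)
         (cover : ∀ {u v} → Adj G u v → ∃ λ i → h i u ≡ h i v)
         {m : ℕ} (nh≤m : ∀ i → ∑[ v < n ] Classes.nh h i v ≤ m)
         (m-small : suc m < n) where

  open Classes h

  -- If all vertices were mapped to `x`, all but `x` would be counted by `nh i`, giving `n ≤ m + 1`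
  -- against `m-small`.
  not-everything : ∀ i x → ∃ λ z → h i z ≢ x
  not-everything i x with any? (λ z → ¬? (h i z ≟ x))
  ... | yes z = z
  ... | no ∄z = contradiction n≤ (ℕ.<⇒≱ m-small)
    where
    open ≤-Reasoning
    once : ∀ v → 1 ≤ ⟦ x ≟ v ⟧ * 1 + nh i v
    once v with h i v ≟ v
    ... | no  _    = m≤n+m 1 _
    ... | yes hv≡v with h i v ≟ x
    ... | no hv≢x  = contradiction (v , hv≢x) ∄z
    ... | yes hv≡x = ≤-trans (≤-reflexive (sym (trans (ℕ.*-identityʳ _) (⟦⟧-yes (x ≟ v) (trans (sym hv≡x) hv≡v))))) (m≤m+n _ 0)
    n≤ : n ≤ suc m
    n≤ = begin
      n                                              ≡⟨ sym (trans (sum-const n 1) (ℕ.*-identityʳ n)) ⟩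
      ∑[ v < n ] 1                                   ≤⟨ sum-mono once ⟩
      ∑[ v < n ] (⟦ x ≟ v ⟧ * 1 + nh i v)            ≡⟨ ∑-distrib-+ (λ v → ⟦ x ≟ v ⟧ * 1) (nh i) ⟩
      ∑[ v < n ] (⟦ x ≟ v ⟧ * 1) + ∑[ v < n ] nh i v ≡⟨ cong (_+ ∑[ v < n ] nh i v) (sum-point (λ _ → 1) x) ⟩
      suc (∑[ v < n ] nh i v)                        ≤⟨ s≤s (nh≤m i) ⟩
      suc m                                          ∎

  -- A vertex of the class outside W has all its neighbours in the class, so the members of the class
  -- in W separate it from the vertices outside the class.
  class⊆W : ∀ {k i x} → k -Connected G → Act i x → b i x < k → ∀ {v} → h i v ≡ x → 2 ≤ d v
  class⊆W {k} {i} {x} (_ , conn) a b<k {v} v∈ with 2 ≤? d v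
  ... | yes 2≤d = 2≤d
  ... | no  2≰d = contradiction (walk (conn X ∣X∣<k (v , v∉X) (z , z∉X)) v∈) z∉
    where
    X? : ∀ u → Dec (h i u ≡ x × 2 ≤ d u)
    X? u = (h i u ≟ x) ×-dec (2 ≤? d u)
    X = tabulate (does ∘ X?)
    z = proj₁ (not-everything i x)
    z∉ : h i z ≢ x
    z∉ = proj₂ (not-everything i x)
    v∉X : v ∉ X
    v∉X v∈X = 2≰d (proj₂ (∈-tabulate⁻ X? v∈X))
    z∉X : z ∉ X
    z∉X z∈X = z∉ (proj₁ (∈-tabulate⁻ X? z∈X))
    product : ∀ u → ⟦ X? u ⟧ ≤ ⟦ h i u ≟ x ⟧ * w u
    product u = ⟦⟧-≤ (X? u) λ (u∈ , 2≤d) →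
      ≤-reflexive (sym (cong₂ _*_ (⟦⟧-yes (h i u ≟ x) u∈) (⟦⟧-yes (2 ≤? d u) 2≤d)))
    ∣X∣<k : ∣ X ∣ < k
    ∣X∣<k = ≤-trans (s≤s (≤-trans (≤-reflexive (∣tabulate∣ X?)) (sum-mono product))) b<k
    walk : ∀ {p p′} → Star (Adj (G − X)) p p′ → h i (proj₁ p) ≡ x → h i (proj₁ p′) ≡ x
    walk ε p∈ = p∈
    walk {p , p∉X} (_◅_ {j = p″ , _} pp″ path) p∈ with cover pp″
    ... | j , eq with j ≟ i
    ... | yes refl = walk path (trans (sym eq) p∈)
    ... | no  j≢i  = contradiction (∈-tabulate⁺ X? (p∈ , act₂⇒2≤d j≢i (shared⇒act j eq (Adj⇒≢ G pp″)) (subst (Act i) (sym p∈) a))) p∉X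

  module _ {k : ℕ} (conn : k -Connected G) (2≤k : 2 ≤ k) where

    1≤d : ∀ v → 1 ≤ d v
    1≤d v =
      let u , vu = neighbour {G = G} (≤-trans 2≤k (ℕ.<⇒≤ (proj₁ conn))) (-Connected⇒Connected {G = G} (≤-trans (n≤1+n 1) 2≤k) conn) v
          i , eq = cover vu
      in  act⇒1≤d (shared⇒act i eq (Adj⇒≢ G vu))

    -- If `b i x < 2`, then `class⊆W` puts the whole class into W, and its members `u` and `x`
    -- already give `b i x ≥ 2`.
    2≤b : ∀ {i x} → Act i x → 2 ≤ b i x
    2≤b {i} {x} a@(u , u≢x , hu≡x) with 2 ≤? b i x
    ... | yes 2≤b = 2≤b
    ... | no  2≰b = ≤-trans (+-mono-≤ (one hu≡x) (one hx≡x)) (two-terms≤sum (λ v → ⟦ h i v ≟ x ⟧ * w v) u≢x)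
      where
      one : ∀ {v} → h i v ≡ x → 1 ≤ ⟦ h i v ≟ x ⟧ * w v
      one {v} v∈ = ≤-reflexive (sym (cong₂ _*_ (⟦⟧-yes (h i v ≟ x) v∈)
        (⟦⟧-yes (2 ≤? d v) (class⊆W conn a (≤-trans (≰⇒> 2≰b) 2≤k) v∈))))
      hx≡x : h i x ≡ x
      hx≡x = trans (cong (h i) (sym hu≡x)) (trans (idem i u) hu≡x)

    -- Here `e = r m - (n - 1)`. By `excess-bound`, `β + δ ≤ 2 (e - 1)`, so both the number of cut
    -- vertices and the excess of the cells over `m` are linear in `e`, `N` and `P`.
    bounded-separation : 1 ≤ r → (q P : ℕ) →
      (∀ {i x} → Act i x → ¬ Special.Special h q i x → size i x ≤ P) →
      ∃ λ e → n + e ≡ r * m + 1 × 1 ≤ e ×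
      ∃ λ (B : BalancedSeparation r G) → ∣ separator B ∣ ≤ (9 * r + 4 * (r * r)) * (e + (Special.N h q + P))
    bounded-separation 1≤r q P light = suc gap , n+e≡ , s≤s z≤n , proj₁ result , (begin
        ∣ separator (proj₁ result) ∣
          ≤⟨ proj₂ result ⟩
        r * (σ + 2 * r) + r * (gap + r * (β + N + 2 + P))
          ≤⟨ +-mono-≤ (*-monoʳ-≤ r (+-monoˡ-≤ (2 * r) σ≤))
                      (*-monoʳ-≤ r (+-monoʳ-≤ gap (*-monoʳ-≤ r (+-monoˡ-≤ P (+-monoˡ-≤ 2 (+-monoˡ-≤ N β≤)))))) ⟩
        r * (8 * gap + 2 * N + 2 * r) + r * (gap + r * (2 * gap + N + 2 + P))
          -- Expanded, the sum has `9 * r` in the coefficient of `gap` and the constant term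
          -- `4 * (r * r)`. The padding raises every coefficient to `9 * r + 4 * (r * r)`.
          ≤⟨ m≤m+n _ _ ⟩
        r * (8 * gap + 2 * N + 2 * r) + r * (gap + r * (2 * gap + N + 2 + P))
          + (2 * (r * r) * gap + 9 * r + (7 * r + 3 * (r * r)) * N + (9 * r + 3 * (r * r)) * P)
          ≡⟨ collect r gap N P ⟩
        (9 * r + 4 * (r * r)) * (suc gap + (N + P)) ∎)
      where
      open Special h q
      open ≤-Reasoning
      M σ gap : ℕ
      -- Large enough both for the special classes put into a cell at the start, `m + (β + N)`, and
      -- for a cell during the filling, `m + 2 + P`.
      M = m + (β + N) + (2 + P)
      σ = δ + (3 * β + 2 * N)
      gap = r * m ∸ n
      excess : 2 * n + (β + δ) ≤ 2 * (r * m)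
      excess = excess-bound nh≤m 1≤d 2≤b
      n≤rm : n ≤ r * m
      n≤rm = ℕ.*-cancelˡ-≤ 2 (≤-trans (m≤m+n (2 * n) (β + δ)) excess)
      n+gap : n + gap ≡ r * m
      n+gap = m+[n∸m]≡n n≤rm
      n+e≡ : n + suc gap ≡ r * m + 1
      n+e≡ = trans (ℕ.+-suc n gap) (trans (cong suc n+gap) (+-comm 1 (r * m)))
      β+δ≤ : β + δ ≤ 2 * gap
      β+δ≤ = +-cancelˡ-≤ (2 * n) _ _ (≤-trans excess (≤-reflexive (trans (cong (2 *_) (sym n+gap)) (ℕ.*-distribˡ-+ 2 n gap))))
      β≤ : β ≤ 2 * gap
      β≤ = ≤-trans (m≤m+n β δ) β+δ≤
      σ≤ : σ ≤ 8 * gap + 2 * N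
      σ≤ = begin
        δ + (3 * β + 2 * N)            ≡⟨ regroup δ β N ⟩
        (β + δ) + 2 * β + 2 * N        ≤⟨ +-monoˡ-≤ (2 * N) (+-mono-≤ β+δ≤ (*-monoʳ-≤ 2 β≤)) ⟩
        2 * gap + 2 * (2 * gap) + 2 * N ≤⟨ m≤m+n _ (2 * gap) ⟩
        2 * gap + 2 * (2 * gap) + 2 * N + 2 * gap ≡⟨ regroup′ gap N ⟩
        8 * gap + 2 * N                ∎
        where
        regroup : ∀ δ β N → δ + (3 * β + 2 * N) ≡ (β + δ) + 2 * β + 2 * N
        regroup = solve-∀
        regroup′ : ∀ g N → 2 * g + 2 * (2 * g) + 2 * N + 2 * g ≡ 8 * g + 2 * N
        regroup′ = solve-∀
      room : n < r * suc m
      room = ≤-trans (+-mono-≤ 1≤r n≤rm) (≤-reflexive (sym (ℕ.*-suc r m)))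
      M-large : m + 2 + P ≤ M
      M-large = ≤-trans (m≤m+n (m + 2 + P) (β + N)) (≤-reflexive (regroup m P (β + N)))
        where
        regroup : ∀ m P k → m + 2 + P + k ≡ m + k + (2 + P)
        regroup = solve-∀
      rM≤ : r * M ≤ n + (gap + r * (β + N + 2 + P))
      rM≤ = ≤-reflexive (trans (expand r m (β + N) P) (trans (cong (_+ r * (β + N + 2 + P)) (sym n+gap)) (+-assoc n gap _)))
        where
        expand : ∀ r m k P → r * (m + k + (2 + P)) ≡ r * m + r * (k + 2 + P)
        expand = solve-∀
      result = Greedy.Filling.separation h q m P M σ 1≤d light room M-large
        (λ i → ≤-trans (special-bound nh≤m i) (m≤m+n _ (2 + P))) (cut-bound 2≤b)
        G cover (fromℕ< (≤-trans (s≤s z≤n) m-small)) 1≤r rM≤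
      collect : ∀ r g N P → r * (8 * g + 2 * N + 2 * r) + r * (g + r * (2 * g + N + 2 + P))
          + (2 * (r * r) * g + 9 * r + (7 * r + 3 * (r * r)) * N + (9 * r + 3 * (r * r)) * P)
          ≡ (9 * r + 4 * (r * r)) * (suc g + (N + P))
      collect = solve-∀

-- The constant, and the two cases of the theorem.

floor-sqrt : ∀ n → ∃ λ q → q * q ≤ n × n < suc q * suc q
floor-sqrt zero    = 0 , z≤n , s≤s z≤n
floor-sqrt (suc n) with floor-sqrt n
... | q , q²≤n , n<[1+q]² with suc q * suc q ≤? suc n
... | no  ≰   = q , ≤-trans q²≤n (n≤1+n n) , ≰⇒> ≰
... | yes ≤1+n = suc q , ≤1+n ,
  ≤-trans (s≤s n<[1+q]²) (ℕ.*-mono-< (ℕ.n<1+n (suc q)) (ℕ.n<1+n (suc q)))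

square-cancel-≤ : ∀ {a b} → a * a ≤ b * b → a ≤ b
square-cancel-≤ {a} {b} a²≤b² with a ≤? b
... | yes a≤b = a≤b
... | no  a≰b = contradiction (ℕ.*-mono-< (≰⇒> a≰b) (≰⇒> a≰b)) (ℕ.≤⇒≯ a²≤b²)

trivial-separation : {n r : ℕ} (G : Graph (Fin n)) → ∃ λ (B : BalancedSeparation r G) → ∣ separator B ∣ ≤ n
trivial-separation {n} {r} G =
  let B , ≤n = equalise G {C = λ _ _ → ⊥} (λ _ _ → no id) (λ ()) (λ ()) 0 (λ _ → z≤n)
  in  B , ≤-trans (m≤m+n _ (r * 0)) ≤n

scale : ℕ → ℕ
scale r = 9 * r + 4 * (r * r)

-- The factor `suc r` pays for `N ≤ r * suc q` when only 2-connectivity is given. The factor 3 comes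
-- from `e + 2 ≤ 3 * e` in the 3-connected case, and otherwise allows `two-arith` to absorb the
-- terms in `q`.
constant : ℕ → ℕ
constant r = 3 * (scale r * suc r)

three-arith : ∀ {s N e} K r → 1 ≤ e → N ≤ 0 → s ≤ K * (e + (N + 2)) → s ≤ 3 * (K * suc r) * e
three-arith {s} {N} {e} K r 1≤e N≤0 s≤ = begin
  s                       ≤⟨ s≤ ⟩
  K * (e + (N + 2))       ≤⟨ *-monoʳ-≤ K (+-monoʳ-≤ e (+-monoˡ-≤ 2 N≤0)) ⟩
  K * (e + 2 * 1)         ≤⟨ *-monoʳ-≤ K (+-monoʳ-≤ e (*-monoʳ-≤ 2 1≤e)) ⟩
  K * (e + 2 * e)         ≤⟨ m≤m+n _ (3 * (K * r) * e) ⟩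
  K * (e + 2 * e) + 3 * (K * r) * e ≡⟨ collect K r e ⟩
  3 * (K * suc r) * e     ∎
  where
  open ≤-Reasoning
  collect : ∀ K r e → K * (e + 2 * e) + 3 * (K * r) * e ≡ 3 * (K * suc r) * e
  collect = solve-∀

-- With `A = K * suc r`, the separator has at most `A * (e + q)` vertices, and `A * q` is at most a
-- third of `s` by hypothesis, so it is absorbed on the left.
two-arith : ∀ {s N e q} K r → 1 ≤ e → N ≤ r * suc q → 3 * (K * suc r) * q ≤ s →
            s ≤ K * (e + (N + q)) → s ≤ 3 * (K * suc r) * e
two-arith {s} {N} {e} {q} K r 1≤e N≤ Cq≤s s≤ = ℕ.*-cancelˡ-≤ 2 (+-cancelʳ-≤ s _ _ (begin
  2 * s + s                         ≡⟨ triple s ⟩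
  3 * s                             ≤⟨ *-monoʳ-≤ 3 s≤′ ⟩
  3 * (A * (e + q))                 ≡⟨ distribute A e q ⟩
  3 * A * e + 3 * A * q             ≤⟨ +-monoʳ-≤ (3 * A * e) Cq≤s ⟩
  3 * A * e + s                     ≤⟨ +-monoˡ-≤ s (m≤m+n (3 * A * e) _) ⟩
  2 * (3 * A * e) + s               ∎))
  where
  open ≤-Reasoning
  A = K * suc r
  triple : ∀ s → 2 * s + s ≡ 3 * s
  triple = solve-∀
  distribute : ∀ A e q → 3 * (A * (e + q)) ≡ 3 * A * e + 3 * A * q
  distribute = solve-∀
  regroup : ∀ K e r q → K * (e + (r * suc q + q)) ≡ K * (e + r * 1 + (r * q + q))
  regroup = solve-∀
  collect : ∀ K e r q → K * (e + r * e + (r * q + q)) ≡ K * suc r * (e + q)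
  collect = solve-∀
  s≤′ : s ≤ A * (e + q)
  s≤′ = begin
    s                             ≤⟨ s≤ ⟩
    K * (e + (N + q))             ≤⟨ *-monoʳ-≤ K (+-monoʳ-≤ e (+-monoˡ-≤ q N≤)) ⟩
    K * (e + (r * suc q + q))     ≡⟨ regroup K e r q ⟩
    K * (e + r * 1 + (r * q + q)) ≤⟨ *-monoʳ-≤ K (+-monoˡ-≤ (r * q + q) (+-monoʳ-≤ e (*-monoʳ-≤ r 1≤e))) ⟩
    K * (e + r * e + (r * q + q)) ≡⟨ collect K e r q ⟩
    K * suc r * (e + q)           ∎

module _ {n r : ℕ} (2≤r : 2 ≤ r) (G : Graph (Fin n)) (h : Fin r → Fin n → Fin n)
         (idem : ∀ i v → h i (h i v) ≡ h i v)
         (cover : ∀ {u v} → Adj G u v → ∃ λ i → h i u ≡ h i v)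
         {m : ℕ} (nh≤m : ∀ i → ∑[ v < n ] Classes.nh h i v ≤ m)
         {s : ℕ} (s-minimal : (B : BalancedSeparation r G) → s ≤ ∣ separator B ∣) where

  private
    K C : ℕ
    K = scale r
    C = constant r

    1≤r : 1 ≤ r
    1≤r = ≤-trans (n≤1+n 1) 2≤r

    1≤K : 1 ≤ K
    1≤K = ≤-trans (*-mono-≤ {1} {9} (s≤s z≤n) 1≤r) (m≤m+n (9 * r) _)

    open Classes h
    open ≤-Reasoning

    -- From `m ≥ n - 1` and `r ≥ 2` follows `e ≥ n - 1`, so `e` is of the order of `n`, while
    -- `s ≤ n` always holds.
    dense-case : 2 ≤ n → n ≤ suc m → ∃ λ e → n + e ≡ r * m + 1 × s ≤ C * e
    dense-case (s≤s {n = n′} 1≤n′) (s≤s n′≤m) = e , n+e≡ , (begin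
      s           ≤⟨ ≤-trans (s-minimal (proj₁ trivial)) (proj₂ trivial) ⟩
      1 + n′      ≤⟨ +-mono-≤ (≤-trans 1≤n′ n′≤e) n′≤e ⟩
      e + e       ≡⟨ cong (e +_) (sym (+-identityʳ e)) ⟩
      2 * e       ≤⟨ *-monoˡ-≤ e (*-mono-≤ {2} {3} (s≤s (s≤s z≤n)) (*-mono-≤ 1≤K (s≤s z≤n))) ⟩
      C * e       ∎)
      where
      trivial = trivial-separation G
      e = r * m ∸ n′
      2n′≤ : 2 * n′ ≤ r * m
      2n′≤ = *-mono-≤ 2≤r n′≤m
      n′+e : n′ + e ≡ r * m
      n′+e = m+[n∸m]≡n (≤-trans (m≤m+n n′ (n′ + 0)) 2n′≤)
      n′≤e : n′ ≤ e
      n′≤e = +-cancelˡ-≤ n′ n′ e (begin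
        n′ + n′  ≡⟨ cong (n′ +_) (sym (+-identityʳ n′)) ⟩
        2 * n′   ≤⟨ 2n′≤ ⟩
        r * m    ≡⟨ sym n′+e ⟩
        n′ + e   ∎)
      n+e≡ : suc n′ + e ≡ r * m + 1
      n+e≡ = trans (cong suc n′+e) (+-comm 1 (r * m))

    module _ (m-small : suc m < n) where

      open Separation G h idem cover nh≤m m-small

      -- With q = r n no class is special on account of its size, and a class whose vertices have
      -- degree at least 2 has as many elements as vertices in W.
      three-connected-case : 3 -Connected G → ∃ λ e → n + e ≡ r * m + 1 × s ≤ C * e
      three-connected-case conn = conclude (bounded-separation conn (n≤1+n 2) 1≤r (r * n) 2 light)
        where
        open Special h (r * n)
        light : ∀ {i x} → Act i x → ¬ Special i x → size i x ≤ 2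
        light {i} {x} a ¬s with 3 ≤? b i x
        ... | yes 3≤b = contradiction (a , inj₁ 3≤b) ¬s
        ... | no  3≰b = ≤-trans (sum-mono size≤b) (ℕ.≤-pred (≰⇒> 3≰b))
          where
          size≤b : ∀ v → ⟦ h i v ≟ x ⟧ ≤ ⟦ h i v ≟ x ⟧ * w v
          size≤b v = ⟦⟧-≤ (h i v ≟ x) λ v∈ → ≤-reflexive (sym (cong₂ _*_ (⟦⟧-yes (h i v ≟ x) v∈)
            (⟦⟧-yes (2 ≤? d v) (class⊆W conn a (≰⇒> 3≰b) v∈))))
        N≤0 : ∀ k → k * suc (r * n) ≤ r * n → k ≤ 0
        N≤0 zero    _ = z≤n
        N≤0 (suc k) k≤ = contradiction (≤-trans (m≤m+n (suc (r * n)) _) k≤) (<-irrefl refl)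
        conclude : (∃ λ e → n + e ≡ r * m + 1 × 1 ≤ e ×
                    ∃ λ (B : BalancedSeparation r G) → ∣ separator B ∣ ≤ scale r * (e + (N + 2))) →
                   ∃ λ e → n + e ≡ r * m + 1 × s ≤ C * e
        conclude (e , n+e≡ , 1≤e , B , ≤K) =
          e , n+e≡ , three-arith (scale r) r 1≤e (N≤0 N N-bound) (≤-trans (s-minimal B) ≤K)

      -- The threshold `q` is the integer part of √n. Then `n < (q + 1)²` turns `N-bound` into
      -- `N ≤ r * suc q`, the remaining classes have at most `q` elements, and the assumption on `s`
      -- yields `C * q ≤ s`.
      two-connected-case : 2 -Connected G → C * C * n ≤ s * s → ∃ λ e → n + e ≡ r * m + 1 × s ≤ C * e
      two-connected-case conn C²n≤s² = conclude (bounded-separation conn ≤-refl 1≤r q q light)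
        where
        q = proj₁ (floor-sqrt n)
        q²≤n : q * q ≤ n
        q²≤n = proj₁ (proj₂ (floor-sqrt n))
        n<[1+q]² : n < suc q * suc q
        n<[1+q]² = proj₂ (proj₂ (floor-sqrt n))
        open Special h q
        light : ∀ {i x} → Act i x → ¬ Special i x → size i x ≤ q
        light a ¬s = ≮⇒≥ λ q<size → ¬s (a , inj₂ q<size)
        Cq≤s : C * q ≤ s
        Cq≤s = square-cancel-≤ (≤-trans (≤-reflexive (shuffle C q)) (≤-trans (*-monoʳ-≤ (C * C) q²≤n) C²n≤s²))
          where
          shuffle : ∀ C q → C * q * (C * q) ≡ C * C * (q * q)
          shuffle = solve-∀
        N≤ : N ≤ r * suc q
        N≤ = ℕ.*-cancelʳ-≤ N (r * suc q) (suc q) (begin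
          N * suc q             ≤⟨ N-bound ⟩
          r * n                 ≤⟨ *-monoʳ-≤ r (ℕ.<⇒≤ n<[1+q]²) ⟩
          r * (suc q * suc q)   ≡⟨ sym (ℕ.*-assoc r (suc q) (suc q)) ⟩
          r * suc q * suc q     ∎)
        conclude : (∃ λ e → n + e ≡ r * m + 1 × 1 ≤ e ×
                    ∃ λ (B : BalancedSeparation r G) → ∣ separator B ∣ ≤ scale r * (e + (N + q))) →
                   ∃ λ e → n + e ≡ r * m + 1 × s ≤ C * e
        conclude (e , n+e≡ , 1≤e , B , ≤K) =
          e , n+e≡ , two-arith (scale r) r 1≤e N≤ Cq≤s (≤-trans (s-minimal B) ≤K)

  separation-number-bound : 3 -Connected G ⊎ (2 -Connected G × C * C * n ≤ s * s) →
                            ∃ λ e → n + e ≡ r * m + 1 × s ≤ C * e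
  separation-number-bound (inj₁ conn) with suc m <? n
  ... | yes m-small = three-connected-case m-small conn
  ... | no  m-large = dense-case (≤-trans (n≤1+n 2) (ℕ.<⇒≤ (proj₁ conn))) (≮⇒≥ m-large)
  separation-number-bound (inj₂ (conn , C²n≤s²)) with suc m <? n
  ... | yes m-small = two-connected-case m-small conn C²n≤s²
  ... | no  m-large = dense-case (ℕ.<⇒≤ (proj₁ conn)) (≮⇒≥ m-large)

-- Rooted spanning trees and their colour counts.

T-does⁺ : {P : Set} (P? : Dec P) → P → T (does P?)
T-does⁺ (yes _) _ = _
T-does⁺ (no ¬p) p = ¬p p

T-does⁻ : {P : Set} (P? : Dec P) → T (does P?) → P
T-does⁻ (yes p) _ = p

argmax : {k : ℕ} (f : Fin (suc k) → ℕ) → ∃ λ i → ∀ j → f j ≤ f i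
argmax {zero}  f = zero , λ where zero → ≤-refl
argmax {suc k} f with argmax (f ∘ suc)
... | i , i-max with f (suc i) ≤? f zero
... | yes i≤0 = zero , λ where zero → ≤-refl ; (suc j) → ≤-trans (i-max j) i≤0
... | no  i≰0 = suc i , λ where zero → ℕ.<⇒≤ (≰⇒> i≰0) ; (suc j) → i-max j

module _ {V : Set} {G : Graph V} (C : Cycle G) where

  open Cycle C

  cycle-neighbours : ∀ i → ∃₂ λ j k → j ≢ k × (Adj G (vertex i) (vertex j) ⊎ Adj G (vertex j) (vertex i))
                                            × (Adj G (vertex i) (vertex k) ⊎ Adj G (vertex k) (vertex i))
  cycle-neighbours zero    = suc zero , fromℕ (2 + ℓ) , (λ ()) , inj₁ (step zero) , inj₂ closing
  cycle-neighbours (suc i) with view i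
  ... | ‵fromℕ     = inject₁ (fromℕ (1 + ℓ)) , zero , (λ ()) , inj₂ (step (fromℕ (1 + ℓ))) , inj₁ closing
  ... | ‵inject₁ i = inject₁ (inject₁ i) , suc (suc i) , distant , inj₂ (step (inject₁ i)) , inj₁ (step (suc i))
    where
    distant : inject₁ (inject₁ i) ≢ suc (suc i)
    distant eq = ℕ.m≢1+n+m (toℕ i) {1}
      (trans (sym (trans (Fin.toℕ-inject₁ (inject₁ i)) (Fin.toℕ-inject₁ i))) (cong toℕ eq))

-- The decreasing `τ` makes the parent pointers lead to the root. In the application it is the
-- moment at which a vertex joins the tree.
module RootedTree {n : ℕ} (root : Fin n) (par : Fin n → Fin n) (τ : Fin n → ℕ)
                  (τ-par : ∀ {v} → v ≢ root → τ (par v) < τ v) where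

  Child : Fin n → Fin n → Set
  Child u v = v ≢ root × par v ≡ u

  Child? : ∀ u v → Dec (Child u v)
  Child? u v = ¬? (v ≟ root) ×-dec (par v ≟ u)

  graph : Graph (Fin n)
  graph .adj u v      = does (Child? u v ⊎-dec Child? v u)
  graph .adj-sym u v  = Bool.∨-comm (does (Child? u v)) (does (Child? v u))
  graph .adj-irrefl v = dec-false (Child? v v ⊎-dec Child? v v) [ irrefl , irrefl ]′
    where
    irrefl : ¬ Child v v
    irrefl (v≢root , pv≡v) = <-irrefl (cong τ pv≡v) (τ-par v≢root)

  child⇒adj : ∀ {u v} → Child u v → Adj graph u v
  child⇒adj {u} {v} c = T-does⁺ (Child? u v ⊎-dec Child? v u) (inj₁ c)

  child⇒adj′ : ∀ {u v} → Child u v → Adj graph v u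
  child⇒adj′ {u} {v} c = T-does⁺ (Child? v u ⊎-dec Child? u v) (inj₂ c)

  adj⇒child : ∀ {u v} → Adj graph u v → Child u v ⊎ Child v u
  adj⇒child {u} {v} = T-does⁻ (Child? u v ⊎-dec Child? v u)

  child-asym : ∀ {u v} → Child u v → ¬ Child v u
  child-asym (v≢root , refl) (u≢root , pu≡v) =
    <-irrefl refl (≤-trans (τ-par v≢root) (≤-trans (≤-reflexive (cong τ (sym pu≡v))) (ℕ.<⇒≤ (τ-par u≢root))))

  -- Both neighbours on a cycle of a vertex with maximal τ would be its parent.
  graph-acyclic : Acyclic graph
  graph-acyclic C with argmax (τ ∘ Cycle.vertex C)
  ... | i , i-max with cycle-neighbours C i
  ... | j , k , j≢k , ij , ik = j≢k (distinct (trans (sym (parent ij)) (parent ik)))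
    where
    open Cycle C
    parent : ∀ {j} → Adj graph (vertex i) (vertex j) ⊎ Adj graph (vertex j) (vertex i) → par (vertex i) ≡ vertex j
    parent {j} e with [ adj⇒child , [ inj₂ , inj₁ ]′ ∘ adj⇒child ]′ e
    ... | inj₂ (_ , p≡j) = p≡j
    ... | inj₁ (j≢root , pj≡i) = contradiction (i-max j) (ℕ.<⇒≱ (≤-trans (≤-reflexive (cong (suc ∘ τ) (sym pj≡i))) (τ-par j≢root)))

  graph-connected : Connected graph
  graph-connected u v = to-root u (<-wellFounded (τ u)) ◅◅ reverse (λ {a} {b} → subst T (adj-sym graph a b)) (to-root v (<-wellFounded (τ v)))
    where
    to-root : ∀ v → Acc _<_ (τ v) → Star (Adj graph) v root
    to-root v (acc rs) with v ≟ root
    ... | yes refl   = ε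
    ... | no  v≢root = child⇒adj′ (v≢root , refl) ◅ to-root (par v) (rs (τ-par v≢root))

∑≤length : {n : ℕ} {P : Fin n → Set} (P? : ∀ v → Dec (P v)) (xs : List (Fin n)) →
           (∀ v → P v → v ∈ₗ xs) → ∑[ v < n ] ⟦ P? v ⟧ ≤ length xs
∑≤length P? [] P⊆ = ≤-reflexive (sum-0 λ v → ⟦⟧-no (P? v) (λ p → case P⊆ v p of λ ()))
∑≤length {n} {P} P? (x ∷ xs) P⊆ = begin
  ∑[ v < n ] ⟦ P? v ⟧
    ≤⟨ sum-mono (λ v → ⟦⟧-≤ (P? v) (split v)) ⟩
  ∑[ v < n ] (⟦ x ≟ v ⟧ * 1 + ⟦ Q? v ⟧)
    ≡⟨ ∑-distrib-+ (λ v → ⟦ x ≟ v ⟧ * 1) (λ v → ⟦ Q? v ⟧) ⟩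
  ∑[ v < n ] (⟦ x ≟ v ⟧ * 1) + ∑[ v < n ] ⟦ Q? v ⟧
    ≤⟨ +-mono-≤ (≤-reflexive (sum-point (λ _ → 1) x)) (∑≤length Q? xs Q⊆) ⟩
  suc (length xs) ∎
  where
  open ≤-Reasoning
  Q? : ∀ v → Dec (P v × v ≢ x)
  Q? v = P? v ×-dec ¬? (v ≟ x)
  Q⊆ : ∀ v → P v × v ≢ x → v ∈ₗ xs
  Q⊆ v (p , v≢x) with P⊆ v p
  ... | hereₗ v≡x  = contradiction v≡x v≢x
  ... | thereₗ v∈ = v∈
  split : ∀ v → P v → 1 ≤ ⟦ x ≟ v ⟧ * 1 + ⟦ Q? v ⟧
  split v p with x ≟ v
  ... | yes _  = s≤s z≤n
  ... | no x≢v = ≤-reflexive (sym (⟦⟧-yes (Q? v) (p , x≢v ∘ sym)))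

mapMaybe-∈ : {A B : Set} (f : A → Maybe B) {x : A} {y : B} {xs : List A} →
             x ∈ₗ xs → f x ≡ just y → y ∈ₗ mapMaybe f xs
mapMaybe-∈ f {xs = x ∷ xs} (hereₗ refl) eq rewrite eq = hereₗ refl
mapMaybe-∈ f {xs = x ∷ xs} (thereₗ x∈) eq with f x
... | just _  = thereₗ (mapMaybe-∈ f x∈ eq)
... | nothing = mapMaybe-∈ f x∈ eq

edge-∈ : {n : ℕ} (G : Graph (Fin n)) {u v : Fin n} (u<v : toℕ u < toℕ v) (uv : Adj G u v) →
         edge u v u<v uv ∈ₗ edges G
edge-∈ {n} G {u} {v} u<v uv = subst (edge u v u<v uv ∈ₗ_) (sym (proj₂ toEdge))
  (mapMaybe-∈ (proj₁ toEdge) (∈-cartesianProduct⁺ (∈-allFin u) (∈-allFin v)) just-edge)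
  where
  -- The function mapped over the pairs is local to `edges`; unification recovers it here.
  toEdge : Σ[ f ∈ (Fin n × Fin n → Maybe (Edge G)) ] edges G ≡ mapMaybe f (cartesianProduct (allFin n) (allFin n))
  toEdge = _ , refl
  just-edge : proj₁ toEdge (u , v) ≡ just (edge u v u<v uv)
  just-edge with u Fin.<? v | T? (adj G u v)
  ... | yes u<v′ | yes uv′ = cong₂ (λ p q → just (edge u v p q)) (ℕ.<-irrelevant u<v′ u<v) (T-irrelevant uv′ uv)
  ... | yes _    | no ¬uv  = contradiction uv ¬uv
  ... | no u≮v   | _       = contradiction u<v u≮v

module _ {n r : ℕ} {G : Graph (Fin n)} (f : Colouring r G) where

  -- A colouring reads an edge with its smaller endpoint first; `Coloured` makes the relation
  -- symmetric.
  Forward : Fin r → Fin n → Fin n → Set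
  Forward i u v = Σ[ u<v ∈ toℕ u < toℕ v ] Σ[ uv ∈ Adj G u v ] f (edge u v u<v uv) ≡ i

  Coloured : Fin r → Fin n → Fin n → Set
  Coloured i u v = Forward i u v ⊎ Forward i v u

  Forward? : ∀ i u v → Dec (Forward i u v)
  Forward? i u v with u Fin.<? v | T? (adj G u v)
  ... | no u≮v  | _      = no (u≮v ∘ proj₁)
  ... | yes _   | no ¬uv = no (¬uv ∘ proj₁ ∘ proj₂)
  ... | yes u<v | yes uv with f (edge u v u<v uv) ≟ i
  ... | yes eq = yes (u<v , uv , eq)
  ... | no ¬eq = no λ (p , q , eq) → ¬eq (trans (cong₂ (λ p q → f (edge u v p q)) (ℕ.<-irrelevant u<v p) (T-irrelevant uv q)) eq)

  Coloured? : ∀ i u v → Dec (Coloured i u v)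
  Coloured? i u v = Forward? i u v ⊎-dec Forward? i v u

  coloured-sym : ∀ i {u v} → Coloured i u v → Coloured i v u
  coloured-sym _ = [ inj₂ , inj₁ ]′

  coloured⇒adj : ∀ i {u v} → Coloured i u v → Adj G u v
  coloured⇒adj i         (inj₁ (_ , uv , _)) = uv
  coloured⇒adj i {u} {v} (inj₂ (_ , vu , _)) = subst T (adj-sym G v u) vu

  adj⇒coloured : ∀ {u v} → Adj G u v → ∃ λ i → Coloured i u v
  adj⇒coloured {u} {v} uv with ℕ.<-cmp (toℕ u) (toℕ v)
  ... | tri< u<v _ _ = _ , inj₁ (u<v , uv , refl)
  ... | tri> _ _ v<u = _ , inj₂ (v<u , subst T (adj-sym G u v) uv , refl)
  ... | tri≈ _ u≡v _ = contradiction (Fin.toℕ-injective u≡v) (Adj⇒≢ G uv)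

  module _ (root : Fin n) (par : Fin n → Fin n) (τ : Fin n → ℕ)
           (τ-par : ∀ {v} → v ≢ root → τ (par v) < τ v)
           (par-adj : ∀ {v} → v ≢ root → Adj G v (par v)) where

    open RootedTree root par τ τ-par

    spanning-tree : SpanningTree G
    spanning-tree .tree      = graph
    spanning-tree .subgraph {u} {v} uv with adj⇒child {u} {v} uv
    ... | inj₁ (v≢root , refl) = subst T (adj-sym G v u) (par-adj v≢root)
    ... | inj₂ (u≢root , refl) = par-adj u≢root
    spanning-tree .connected = graph-connected
    spanning-tree .acyclic   = graph-acyclic

    -- Each vertex of `P` is the lower end of its parent edge, which has colour `i`. Sending the
    -- edges of colour `i` to their lower ends therefore covers `P`.
    colourCount-≥ : (i : Fin r) {P : Fin n → Set} (P? : ∀ v → Dec (P v)) →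
                    (∀ v → P v → v ≢ root × Coloured i v (par v)) →
                    ∑[ v < n ] ⟦ P? v ⟧ ≤ colourCount f spanning-tree i
    colourCount-≥ i {P} P? up = ≤-trans (∑≤length P? (map lower i-edges) lower-∈) (≤-reflexive (length-map lower i-edges))
      where
      i? : (e : Edge graph) → Dec (f (include spanning-tree e) ≡ i)
      i? e = f (include spanning-tree e) ≟ i
      i-edges : List (Edge graph)
      i-edges = filter i? (edges graph)
      lower : Edge graph → Fin n
      lower (edge u v _ _) = if does (Child? u v) then v else u
      member : ∀ {u v} (uv : Adj graph u v) → (u→v : Forward i u v) → lower (edge u v (proj₁ u→v) uv) ∈ₗ map lower i-edges
      member {u} {v} uv (u<v , uv′ , eq) = ∈-map⁺ lower (∈-filter⁺ i? (edge-∈ graph u<v uv)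
        (trans (cong (λ q → f (edge u v u<v q)) (T-irrelevant (spanning-tree .subgraph uv) uv′)) eq))
      lower-∈ : ∀ v → P v → v ∈ₗ map lower i-edges
      lower-∈ v p with up v p
      ... | v≢root , inj₁ v→p = subst (_∈ₗ map lower i-edges)
        (cong (λ b → if b then par v else v) (dec-false (Child? v (par v)) (child-asym (v≢root , refl))))
        (member (child⇒adj′ (v≢root , refl)) v→p)
      ... | v≢root , inj₂ p→v = subst (_∈ₗ map lower i-edges)
        (cong (λ b → if b then v else par v) (dec-true (Child? (par v) v) (v≢root , refl)))
        (member (child⇒adj (v≢root , refl)) p→v)

-- Growing a tree that prefers one colour.

upd : {n : ℕ} {A : Set} → (Fin n → A) → Fin n → A → Fin n → A
upd g v a w = if does (w ≟ v) then a else g w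

upd-same : {n : ℕ} {A : Set} (g : Fin n → A) (v : Fin n) {a : A} → upd g v a v ≡ a
upd-same g v {a} = cong (if_then a else g v) (dec-true (v ≟ v) refl)

upd-other : {n : ℕ} {A : Set} (g : Fin n → A) {v w : Fin n} {a : A} → w ≢ v → upd g v a w ≡ g w
upd-other g {v} {w} {a} w≢v = cong (if_then a else g w) (dec-false (w ≟ v) w≢v)

-- Prim's algorithm, preferring edges satisfying P.  The map h sends a vertex to the first reached
-- vertex of its P-component; an edge outside P is used only when no P-edge leaves the tree, so that
-- the P-edges leaving the tree all start in the component of current.
module Prim {n : ℕ} (G : Graph (Fin n)) (conn : Connected G) (root : Fin n)
            (P : Fin n → Fin n → Set) (P? : ∀ u v → Dec (P u v))
            (P-sym : ∀ {u v} → P u v → P v u) (P⇒adj : ∀ {u v} → P u v → Adj G u v) where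

  -- Once all vertices are reached, `closed` keeps every `P`-edge inside a class of `h`, and
  -- `nonhead` makes the parent edge of each vertex other than the head of its class a `P`-edge.
  record Growth : Set where
    field
      members  : List (Fin n)
      par h    : Fin n → Fin n
      τ        : Fin n → ℕ
      current  : Fin n
      root∈    : root ∈ₗ members
      par-ok   : ∀ {v} → v ∈ₗ members → v ≢ root → par v ∈ₗ members × τ (par v) < τ v × Adj G v (par v)
      τ<       : ∀ {v} → v ∈ₗ members → τ v < length members
      h-ok     : ∀ {v} → v ∈ₗ members → h v ∈ₗ members × h (h v) ≡ h v
      nonhead  : ∀ {v} → v ∈ₗ members → h v ≢ v → v ≢ root × P v (par v)
      closed   : ∀ {u v} → u ∈ₗ members → v ∈ₗ members → P u v → h u ≡ h v
      frontier : ∀ {u v} → u ∈ₗ members → v ∉ₗ members → P u v → h u ≡ current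

  open Growth

  -- The new vertex `v` gets the class `head`: that of `u` if `uv` is a `P`-edge chosen by
  -- preference, and `v` itself if no `P`-edge leaves the tree, when `leaving` holds vacuously.
  module _ (S : Growth) {u v : Fin n} (u∈ : u ∈ₗ members S) (v∉ : v ∉ₗ members S) (vu : Adj G v u)
           (head : Fin n) (head-ok : head ≡ v ⊎ (head ∈ₗ members S × h S head ≡ head × P v u))
           (leaving : ∀ {w w′} → w ∈ₗ members S → w′ ∉ₗ members S → P w w′ → h S w ≡ head) where

    private
      ≢v : ∀ {w} → w ∈ₗ members S → w ≢ v
      ≢v w∈ w≡v = v∉ (subst (_∈ₗ members S) w≡v w∈)

      par′ h′ : Fin n → Fin n
      par′ = upd (par S) v u
      h′   = upd (h S) v head
      τ′ : Fin n → ℕ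
      τ′ = upd (τ S) v (length (members S))

      old : {A : Set} (g : Fin n → A) {a : A} → ∀ {w} → w ∈ₗ members S → upd g v a w ≡ g w
      old g w∈ = upd-other g (≢v w∈)

      par-ok′ : ∀ {w} → w ∈ₗ v ∷ members S → w ≢ root → par′ w ∈ₗ v ∷ members S × τ′ (par′ w) < τ′ w × Adj G w (par′ w)
      par-ok′ (hereₗ refl) _ rewrite upd-same (par S) v {u} | upd-same (τ S) v {length (members S)} | old (τ S) {length (members S)} u∈ =
        thereₗ u∈ , τ< S u∈ , vu
      par-ok′ (thereₗ w∈) w≢root with par-ok S w∈ w≢root
      ... | p∈ , τp<τw , wp rewrite old (par S) {u} w∈ | old (τ S) {length (members S)} w∈ | old (τ S) {length (members S)} p∈ =
        thereₗ p∈ , τp<τw , wp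

      τ<′ : ∀ {w} → w ∈ₗ v ∷ members S → τ′ w < suc (length (members S))
      τ<′ (hereₗ refl) rewrite upd-same (τ S) v {length (members S)} = ≤-refl
      τ<′ (thereₗ w∈) rewrite old (τ S) {length (members S)} w∈ = ≤-trans (τ< S w∈) (n≤1+n _)

      h-ok′ : ∀ {w} → w ∈ₗ v ∷ members S → h′ w ∈ₗ v ∷ members S × h′ (h′ w) ≡ h′ w
      h-ok′ (hereₗ refl) rewrite upd-same (h S) v {head} =
        [ (λ head≡v → hereₗ head≡v , trans (cong h′ head≡v) (upd-same (h S) v))
        , (λ (head∈ , hh , _) → thereₗ head∈ , trans (old (h S) head∈) hh) ]′ head-ok
      h-ok′ (thereₗ w∈) rewrite old (h S) {head} w∈ =
        thereₗ (proj₁ (h-ok S w∈)) , trans (old (h S) (proj₁ (h-ok S w∈))) (proj₂ (h-ok S w∈))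

      nonhead′ : ∀ {w} → w ∈ₗ v ∷ members S → h′ w ≢ w → w ≢ root × P w (par′ w)
      nonhead′ (hereₗ refl) h′≢ rewrite upd-same (h S) v {head} | upd-same (par S) v {u} =
        [ (λ head≡v → contradiction head≡v h′≢)
        , (λ (_ , _ , p) → (λ v≡root → v∉ (subst (_∈ₗ members S) (sym v≡root) (root∈ S))) , p) ]′ head-ok
      nonhead′ (thereₗ w∈) h′≢ rewrite old (h S) {head} w∈ | old (par S) {u} w∈ = nonhead S w∈ h′≢

      closed′ : ∀ {w w′} → w ∈ₗ v ∷ members S → w′ ∈ₗ v ∷ members S → P w w′ → h′ w ≡ h′ w′
      closed′ (hereₗ refl) (hereₗ refl) _ = refl
      closed′ (hereₗ refl) (thereₗ w′∈) p =
        trans (upd-same (h S) v) (trans (sym (leaving w′∈ v∉ (P-sym p))) (sym (old (h S) w′∈)))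
      closed′ (thereₗ w∈) (hereₗ refl) p =
        trans (old (h S) w∈) (trans (leaving w∈ v∉ p) (sym (upd-same (h S) v)))
      closed′ (thereₗ w∈) (thereₗ w′∈) p = trans (old (h S) w∈) (trans (closed S w∈ w′∈ p) (sym (old (h S) w′∈)))

      frontier′ : ∀ {w w′} → w ∈ₗ v ∷ members S → w′ ∉ₗ v ∷ members S → P w w′ → h′ w ≡ head
      frontier′ (hereₗ refl) _   _ = upd-same (h S) v
      frontier′ (thereₗ w∈) w′∉ p = trans (old (h S) w∈) (leaving w∈ (w′∉ ∘ thereₗ) p)

    extend : Growth
    extend = record
      { members = v ∷ members S ; par = par′ ; h = h′ ; τ = τ′ ; current = head
      ; root∈ = thereₗ (root∈ S) ; par-ok = par-ok′ ; τ< = τ<′ ; h-ok = h-ok′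
      ; nonhead = nonhead′ ; closed = closed′ ; frontier = frontier′ }

  private
    initial : Growth
    initial = record
      { members = root ∷ [] ; par = id ; h = id ; τ = λ _ → 0 ; current = root
      ; root∈ = hereₗ refl
      ; par-ok = λ { (hereₗ refl) v≢root → contradiction refl v≢root }
      ; τ< = λ _ → s≤s z≤n
      ; h-ok = λ v∈ → v∈ , refl
      ; nonhead = λ _ v≢v → contradiction refl v≢v
      ; closed = λ { (hereₗ refl) (hereₗ refl) _ → refl }
      ; frontier = λ { (hereₗ refl) _ _ → refl } }

    _∈?ₗ_ : ∀ v (xs : List (Fin n)) → Dec (v ∈ₗ xs)
    v ∈?ₗ xs = Any.any? (v ≟_) xs

    crossing : (S : Growth) → ∀ {a b} → Star (Adj G) a b → a ∈ₗ members S → b ∉ₗ members S →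
               ∃₂ λ u v → u ∈ₗ members S × v ∉ₗ members S × Adj G u v
    crossing S ε a∈ a∉ = contradiction a∈ a∉
    crossing S {a} (_◅_ {j = c} ac path) a∈ b∉ with c ∈?ₗ members S
    ... | yes c∈ = crossing S path c∈ b∉
    ... | no  c∉ = a , c , a∈ , c∉ , ac

    grow : (S : Growth) → ∀ {z} → z ∉ₗ members S →
           Σ[ S′ ∈ Growth ] ∃ λ v → v ∉ₗ members S × members S′ ≡ v ∷ members S
    grow S {z} z∉ with any? (λ u → any? λ v → (u ∈?ₗ members S) ×-dec (¬? (v ∈?ₗ members S) ×-dec P? u v))
    ... | yes (u , v , u∈ , v∉ , p) =
      extend S u∈ v∉ (P⇒adj (P-sym p)) (h S u)
        (inj₂ (proj₁ (h-ok S u∈) , proj₂ (h-ok S u∈) , P-sym p))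
        (λ w∈ w′∉ q → trans (frontier S w∈ w′∉ q) (sym (frontier S u∈ v∉ p))) ,
      v , v∉ , refl
    ... | no ∄p =
      let u , v , u∈ , v∉ , uv = crossing S (conn root z) (root∈ S) z∉
      in  extend S u∈ v∉ (subst T (adj-sym G u v) uv) v (inj₁ refl)
            (λ w∈ w′∉ q → contradiction (_ , _ , w∈ , w′∉ , q) ∄p) ,
          v , v∉ , refl

    missing : Growth → ℕ
    missing S = ∑[ v < n ] ⟦ ¬? (v ∈?ₗ members S) ⟧

    finish : (S : Growth) → Acc _<_ (missing S) → Σ[ S′ ∈ Growth ] (∀ v → v ∈ₗ members S′)
    finish S (acc rs) with any? (λ v → ¬? (v ∈?ₗ members S))
    ... | no  ∄z = S , λ v → decidable-stable (v ∈?ₗ members S) (λ v∉ → ∄z (v , v∉))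
    ... | yes (z , z∉) with grow S z∉
    ... | S′ , v , v∉ , eq = finish S′ (rs (sum-mono-<
      (λ w → ⟦⟧-mono (¬? (w ∈?ₗ members S′)) (¬? (w ∈?ₗ members S)) (λ w∉ w∈ → w∉ (subst (w ∈ₗ_) (sym eq) (thereₗ w∈))))
      v (≤-reflexive (trans (cong suc (⟦⟧-no (¬? (v ∈?ₗ members S′)) (λ v∉′ → v∉′ (subst (v ∈ₗ_) (sym eq) (hereₗ refl)))))
                            (sym (⟦⟧-yes (¬? (v ∈?ₗ members S)) v∉))))))

  spanning : Σ[ S ∈ Growth ] (∀ v → v ∈ₗ members S)
  spanning = finish initial (<-wellFounded (missing initial))

-- From the spanning trees to a bound for one colouring.

colourCount≤max : {n r : ℕ} {G : Graph (Fin n)} (f : Colouring r G) (S : SpanningTree G) (i : Fin r) →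
                  colourCount f S i ≤ maxColourCount f S
colourCount≤max {r = r} f S i =
  All.lookup (Extrema.xs≤max 0 (map (colourCount f S) (allFin r))) (∈-map⁺ (colourCount f S) (∈-allFin i))

module _ {n r : ℕ} (2≤r : 2 ≤ r) {G : Graph (Fin n)} (f : Colouring r G)
         {m : ℕ} (max≤m : ∀ S → maxColourCount f S ≤ m)
         {s : ℕ} (s-minimal : (B : BalancedSeparation r G) → s ≤ ∣ separator B ∣) where

  private
    module _ (conn : Connected G) (root : Fin n) where

      module P (i : Fin r) =
        Prim G conn root (Coloured f i) (Coloured? f i) (coloured-sym f i) (coloured⇒adj f i)

      module S (i : Fin r) = P.Growth i (proj₁ (P.spanning i))

      all∈ : ∀ i v → v ∈ₗ S.members i
      all∈ i = proj₂ (P.spanning i)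

      τ-par : ∀ i {v} → v ≢ root → S.τ i (S.par i v) < S.τ i v
      τ-par i {v} v≢root = proj₁ (proj₂ (S.par-ok i (all∈ i v) v≢root))

      par-adj : ∀ i {v} → v ≢ root → Adj G v (S.par i v)
      par-adj i {v} v≢root = proj₂ (proj₂ (S.par-ok i (all∈ i v) v≢root))

      preferring : Fin r → SpanningTree G
      preferring i = spanning-tree f root (S.par i) (S.τ i) (τ-par i) (par-adj i)

      -- In the tree preferring colour `i`, every vertex that is not a head has a parent edge of
      -- colour `i`, and this tree has at most `m` such edges.
      nonheads≤m : ∀ i → ∑[ v < n ] Classes.nh S.h i v ≤ m
      nonheads≤m i = ≤-trans
        (colourCount-≥ f root (S.par i) (S.τ i) (τ-par i) (par-adj i) i (λ v → ¬? (S.h i v ≟ v)) (λ v → S.nonhead i (all∈ i v)))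
        (≤-trans (colourCount≤max f (preferring i) i) (max≤m (preferring i)))

      bound : 3 -Connected G ⊎ (2 -Connected G × constant r * constant r * n ≤ s * s) →
              ∃ λ e → n + e ≡ r * m + 1 × s ≤ constant r * e
      bound = separation-number-bound 2≤r G S.h
        (λ i v → proj₂ (S.h-ok i (all∈ i v)))
        (λ {u} {v} uv → let i , c = adj⇒coloured f uv in i , S.closed i (all∈ i u) (all∈ i v) c)
        nonheads≤m s-minimal

  colouring-bound : 3 -Connected G ⊎ (2 -Connected G × constant r * constant r * n ≤ s * s) →
                    ∃ λ e → n + e ≡ r * m + 1 × s ≤ constant r * e
  colouring-bound conn@(inj₁ c)       = bound (-Connected⇒Connected {G = G} (s≤s z≤n) c) (fromℕ< (proj₁ c)) conn
  colouring-bound conn@(inj₂ (c , _)) = bound (-Connected⇒Connected {G = G} (s≤s z≤n) c) (fromℕ< (proj₁ c)) conn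

-- Rational arithmetic and the conclusion.

-- The fraction `i / 1` is normalised by a gcd that does not compute for a variable `i`. Rewriting
-- to the explicit form lets the operations on rationals reduce.
/1≡mkℚ : ∀ i → i / 1 ≡ ℚ.mkℚ i 0 (Coprimality.sym (Coprimality.1-coprimeTo ℤ.∣ i ∣))
/1≡mkℚ i = ℚ.↥p/↧p≡p (ℚ.mkℚ i 0 _)

*-/1 : ∀ i j → (i / 1) ℚ.* (j / 1) ≡ (i ℤ.* j) / 1
*-/1 i j rewrite /1≡mkℚ i | /1≡mkℚ j = refl

+-/1 : ∀ i j → (i / 1) ℚ.+ (j / 1) ≡ (i ℤ.+ j) / 1
+-/1 i j rewrite /1≡mkℚ i | /1≡mkℚ j = cong₂ (λ a b → (a ℤ.+ b) / 1) (ℤ.*-identityʳ i) (ℤ.*-identityʳ j)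

/1-mono-≤ : ∀ {i j} → i ℤ.≤ j → (i / 1) ℚ.≤ (j / 1)
/1-mono-≤ {i} {j} i≤j rewrite /1≡mkℚ i | /1≡mkℚ j =
  ℚ.*≤* (subst₂ ℤ._≤_ (sym (ℤ.*-identityʳ i)) (sym (ℤ.*-identityʳ j)) i≤j)

/1-cancel-≤ : ∀ {i j} → (i / 1) ℚ.≤ (j / 1) → i ℤ.≤ j
/1-cancel-≤ {i} {j} le rewrite /1≡mkℚ i | /1≡mkℚ j =
  subst₂ ℤ._≤_ (ℤ.*-identityʳ i) (ℤ.*-identityʳ j) (ℚ.drop-*≤* le)

*-cancel-/ : ∀ i r .{{_ : NonZero r}} → (ℤ.+ r / 1) ℚ.* (i / r) ≡ i / 1
*-cancel-/ i r@(suc _) = ℚ.toℚᵘ-injective (begin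
  ℚ.toℚᵘ ((ℤ.+ r / 1) ℚ.* (i / r))            ≈⟨ ℚ.toℚᵘ-homo-* (ℤ.+ r / 1) (i / r) ⟩
  ℚ.toℚᵘ (ℤ.+ r / 1) ℚᵘ.* ℚ.toℚᵘ (i / r)      ≈⟨ ℚᵘ.*-cong (ℚ.toℚᵘ-fromℚᵘ (ℤ.+ r ℚᵘ./ 1)) (ℚ.toℚᵘ-fromℚᵘ (i ℚᵘ./ r)) ⟩
  (ℤ.+ r ℚᵘ./ 1) ℚᵘ.* (i ℚᵘ./ r)              ≈⟨ ℚᵘ.*≡* (cross i r) ⟩
  i ℚᵘ./ 1                                    ≈⟨ ℚ.toℚᵘ-fromℚᵘ (i ℚᵘ./ 1) ⟨
  ℚ.toℚᵘ (i / 1)                              ∎)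
  where
  open ℚᵘ.≃-Reasoning
  cross : ∀ i r → ℤ.+ r ℤ.* i ℤ.* ℤ.+ 1 ≡ i ℤ.* (ℤ.+ 1 ℤ.* ℤ.+ r)
  cross i r = trans (ℤ.*-identityʳ _) (trans (ℤ.*-comm (ℤ.+ r) i) (cong (i ℤ.*_) (sym (ℤ.*-identityˡ (ℤ.+ r)))))

sub-add : ∀ p q → (p ℚ.- q) ℚ.+ q ≡ p
sub-add p q = trans (ℚ.+-assoc p (ℚ.- q) q) (trans (cong (p ℚ.+_) (ℚ.+-inverseˡ q)) (ℚ.+-identityʳ p))

add-sub : ∀ p q → (p ℚ.+ q) ℚ.- q ≡ p
add-sub p q = trans (ℚ.+-assoc p q (ℚ.- q)) (trans (cong (p ℚ.+_) (ℚ.+-inverseʳ q)) (ℚ.+-identityʳ p))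

floor≤ : ∀ p → (floor p / 1) ℚ.≤ p
floor≤ p@(ℚ.mkℚ a b _) rewrite /1≡mkℚ (floor p) =
  ℚ.*≤* (ℤ.≤-trans (ℤ.[n/d]*d≤n a (ℤ.+ suc b)) (ℤ.≤-reflexive (sym (ℤ.*-identityʳ a))))

floor-÷≤ : ∀ {s c e} → s ≤ c * e → (c>0 : Positive (ℤ.+ c / 1)) →
           (⌊_÷_⌋ s (ℤ.+ c / 1) {{c>0}} / 1) ℚ.≤ (ℤ.+ e / 1)
floor-÷≤ {s} {c} {e} s≤ce c>0 = ℚ.≤-trans (floor≤ ((ℤ.+ s / 1) ℚ.÷ C)) (ℚ.≤-trans
  (ℚ.*-monoʳ-≤-nonNeg (ℚ.1/ C) {{ℚ.pos⇒nonNeg (ℚ.1/ C) {{ℚ.1/pos⇒pos C {{c>0}}}}}} s≤eC)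
  (ℚ.≤-reflexive (trans (ℚ.*-assoc (ℤ.+ e / 1) C (ℚ.1/ C))
    (trans (cong ((ℤ.+ e / 1) ℚ.*_) (ℚ.*-inverseʳ C)) (ℚ.*-identityʳ (ℤ.+ e / 1))))))
  where
  C : ℚ
  C = ℤ.+ c / 1
  instance
    C≢0 : ℚ.NonZero C
    C≢0 = ℚ.pos⇒nonZero C {{c>0}}
  s≤eC : (ℤ.+ s / 1) ℚ.≤ (ℤ.+ e / 1) ℚ.* C
  s≤eC = ℚ.≤-trans
    (/1-mono-≤ (ℤ.+≤+ (≤-trans s≤ce (≤-reflexive (*-comm c e)))))
    (ℚ.≤-reflexive (trans (cong (_/ 1) (ℤ.pos-* e c)) (sym (*-/1 (ℤ.+ e) (ℤ.+ c)))))

√-bound : ∀ {s c n} → s ≥ (ℤ.+ c / 1) √ n → c * c * n ≤ s * s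
√-bound {s} {c} {n} le = ℤ.drop‿+≤+ (/1-cancel-≤ (subst₂ ℚ._≤_
  (trans (cong (ℚ._* (ℤ.+ n / 1)) (square c)) (product (c * c) n)) (square s) le))
  where
  product : ∀ a b → (ℤ.+ a / 1) ℚ.* (ℤ.+ b / 1) ≡ ℤ.+ (a * b) / 1
  product a b = trans (*-/1 (ℤ.+ a) (ℤ.+ b)) (cong (_/ 1) (sym (ℤ.pos-* a b)))
  square : ∀ a → (ℤ.+ a / 1) ℚ.* (ℤ.+ a / 1) ≡ ℤ.+ (a * a) / 1
  square a = product a a

module _ {n r : ℕ} .{{_ : NonZero r}} {G : Graph (Fin n)} (f : Colouring r G) where

  -- For fixed `n` and `r` the discrepancy increases with the largest colour count, so a tree
  -- maximising the former maximises the latter.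
  max-cancel-≤ : ∀ S S′ → treeDiscrepancy f S ℚ.≤ treeDiscrepancy f S′ → maxColourCount f S ≤ maxColourCount f S′
  max-cancel-≤ S S′ le = ℤ.drop‿+≤+ (/1-cancel-≤ (subst₂ ℚ._≤_ (sub-add _ y) (sub-add _ y)
    (ℚ.+-monoˡ-≤ y (ℚ.*-cancelˡ-≤-pos (ℤ.+ r / 1) {{ℚ.normalize-pos r 1}} le))))
    where
    y : ℚ
    y = (ℤ.+ n ℤ.- ℤ.+ 1) / r

  -- The hypothesis is `e = r m - (n - 1)` for the largest colour count `m`, written without
  -- subtraction.
  discrepancy-value : ∀ S e → n + e ≡ r * maxColourCount f S + 1 → treeDiscrepancy f S ≡ ℤ.+ e / 1
  discrepancy-value S e n+e≡ = trans (sym (add-sub (treeDiscrepancy f S) (z / 1)))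
    (trans (cong (ℚ._- (z / 1)) (trans D+z (sym e+z))) (add-sub (ℤ.+ e / 1) (z / 1)))
    where
    mx = maxColourCount f S
    z : ℤ
    z = ℤ.+ n ℤ.- ℤ.+ 1
    D+z : treeDiscrepancy f S ℚ.+ (z / 1) ≡ ℤ.+ (r * mx) / 1
    D+z = trans (cong (treeDiscrepancy f S ℚ.+_) (sym (*-cancel-/ z r)))
      (trans (sym (ℚ.*-distribˡ-+ (ℤ.+ r / 1) ((ℤ.+ mx / 1) ℚ.- (z / r)) (z / r)))
      (trans (cong ((ℤ.+ r / 1) ℚ.*_) (sub-add (ℤ.+ mx / 1) (z / r)))
      (trans (*-/1 (ℤ.+ r) (ℤ.+ mx)) (cong (_/ 1) (sym (ℤ.pos-* r mx))))))
    e+z : (ℤ.+ e / 1) ℚ.+ (z / 1) ≡ ℤ.+ (r * mx) / 1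
    e+z = trans (+-/1 (ℤ.+ e) z) (cong (_/ 1) (begin
      ℤ.+ e ℤ.+ (ℤ.+ n ℤ.- ℤ.+ 1)     ≡⟨ ℤ.+-assoc (ℤ.+ e) (ℤ.+ n) (ℤ.- ℤ.+ 1) ⟨
      ℤ.+ (e + n) ℤ.- ℤ.+ 1           ≡⟨ cong (λ k → ℤ.+ k ℤ.- ℤ.+ 1) (trans (+-comm e n) n+e≡) ⟩
      ℤ.+ (r * mx + 1) ℤ.- ℤ.+ 1      ≡⟨ ℤ.+-assoc (ℤ.+ (r * mx)) (ℤ.+ 1) (ℤ.- ℤ.+ 1) ⟩
      ℤ.+ (r * mx) ℤ.+ ℤ.+ 0          ≡⟨ ℤ.+-identityʳ (ℤ.+ (r * mx)) ⟩
      ℤ.+ (r * mx)                    ∎))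
      where open ≡-Reasoning

constant-nonZero : ∀ r → 2 ≤ r → NonZero (constant r)
constant-nonZero (suc r) _ = _

theorem1p1 : (r : ℕ) .{{_ : NonZero r}} → 2 ≤ r →
    Σ[ C ∈ ℚ ] Σ[ C>0 ∈ Positive C ]
    ((n : ℕ) (G : Graph (Fin n))
    (s : ℕ) → IsSeparationNumber r G s →
    (D : ℚ) → IsSpanningTreeDiscrepancy r G D →
    (3 -Connected G) ⊎ ((2 -Connected G) × (s ≥ C √ n)) →
    (⌊_÷_⌋ s C {{C>0}} / 1) ℚ.≤ D)
theorem1p1 r 2≤r = (ℤ.+ constant r / 1) , C>0 , bound
  where
  C>0 : Positive (ℤ.+ constant r / 1)
  C>0 = ℚ.normalize-pos (constant r) 1 {{_}} {{constant-nonZero r 2≤r}}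
  bound : (n : ℕ) (G : Graph (Fin n)) (s : ℕ) → IsSeparationNumber r G s →
          (D : ℚ) → IsSpanningTreeDiscrepancy r G D →
          (3 -Connected G) ⊎ ((2 -Connected G) × (s ≥ (ℤ.+ constant r / 1) √ n)) →
          (⌊_÷_⌋ s (ℤ.+ constant r / 1) {{C>0}} / 1) ℚ.≤ D
  bound n G s (_ , s-minimal) D ((f , (S , value) , D-max) , _) conn =
    -- The colouring `f` attains the minimum and the tree `S` the maximum for `f`, so the bound `m`
    -- on all trees is `maxColourCount f S`.
    let e , n+e≡ , s≤ = colouring-bound 2≤r f
          (λ S′ → max-cancel-≤ f S′ S (subst (treeDiscrepancy f S′ ℚ.≤_) (sym value) (D-max (S′ , refl))))
          (λ B → s-minimal (B , refl))
          ([ inj₁ , (λ (c , le) → inj₂ (c , √-bound {s} {constant r} {n} le)) ]′ conn)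
    in  subst ((⌊_÷_⌋ s (ℤ.+ constant r / 1) {{C>0}} / 1) ℚ.≤_)
              (trans (sym (discrepancy-value f S e n+e≡)) value) (floor-÷≤ {s} {constant r} {e} s≤ C>0)
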